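{- Let $p$ be a prime, let $K\supset\mu_p$ be a field, and set $A_K^\bullet:=H^\bullet(G_K(p),\mathbb F_p)$. For a subspace $W\subset A_K^1$ let $\langle W\rangle$ denote the graded subalgebra of $A_K^\bullet$ generated by $W$. Assume that for every finite-dimensional subspace $W\subset A_K^1$ there exist: (i) a finite set $S=S(W)$ of places or local data, with associated fields $K_v$ ($v\in S$); (ii) a graded algebra homomorphism $\lambda_S\colon A_K^\bullet\to A_S^\bullet:=\prod_{v\in S}H^\bullet(G_{K_v}(p),\mathbb F_p)$; (iii) a finite-type universally Koszul quadratic algebra $B_W$; (iv) an isomorphism of graded algebras $\phi_W\colon\langle W\rangle\xrightarrow{\sim}B_W$; such that: (a) $\phi_W$ is induced by $\lambda_S$; (b) the family is compatible under inclusion, that is, $W\subset W'$ implies $\langle W\rangle\subset\langle W'\rangle$ and $B_W\subset B_{W'}$. Then $A_K^\bullet$ is a filtered union of finite-type universally Koszul quadratic subalgebras, and hence asymptotically universally Koszul.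
   Context: $\mu_p$ is the group of $p$-th roots of unity. For a field $K$, $G_K(p)$ is the maximal pro-$p$ quotient of the absolute Galois group of $K$, and $H^\bullet(-,\mathbb F_p)$ is continuous cohomology, a graded-commutative $\mathbb F_p$-algebra under cup product. "$\phi_W$ is induced by $\lambda_S$" means that $B_W$ is identified with the subalgebra $\lambda_S(\langle W\rangle)$ of $A_S^\bullet$ and $\phi_W$ with the restriction of $\lambda_S$ to $\langle W\rangle$; "$B_W\subset B_{W'}$" is an inclusion (embedding) of graded algebras. Below $k=\mathbb F_p$. A graded $k$-algebra $A=\bigoplus_{n\ge 0}A_n$ is connected if $A_0=k$. A connected graded $k$-algebra generated in degree $1$ is quadratic if $A\cong T(V)/\langle R\rangle$ as graded algebras, where $V=A_1$ (possibly infinite-dimensional) and $R\subseteq V\otimes_k V$ is a subspace. A quadratic algebra $A$ is of finite type if $\dim_k A_1<\infty$. Universal Koszulity: let $A$ be a quadratic algebra with $\dim_k A_1<\infty$. Let $\mathcal L(A)$ be the set of graded left ideals $I\subseteq A$ with $I=A I_1$ (generated in degree $1$). $A$ is universally Koszul if for every $I\in\mathcal L(A)$ and every $x\in A_1\setminus I_1$, the colon ideal $I:x=\{a\in A\mid ax\in I\}$ belongs to $\mathcal L(A)$. Asymptotic universal Koszulity: a connected graded $k$-algebra $A$ generated in degree $1$ is asymptotically universally Koszul if there exists a filtered system (under inclusion) of quadratic graded subalgebras $(A_i)_{i\in I}$ of $A$ such that (i) each $A_i$ is generated in degree $1$ with $\dim_k(A_i)_1<\infty$; (ii) each $A_i$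 is universally Koszul; (iii) the natural map $\varinjlim_{i\in I}A_i\to A$ is an isomorphism of graded algebras; (iv) every finite-dimensional subspace of $A_1$ is contained in some $(A_i)_1$. That $A_K^\bullet$ is generated in degree $1$ (as a consequence of the norm residue isomorphism theorem) is taken as known. -}

module Defs where

open import Level using (Level; 0ℓ; _⊔_) renaming (suc to lsuc)
open import Algebra.Bundles using (Ring; CommutativeRing; Group)
open import Algebra.Module.Bundles using (LeftModule)
open import Algebra.Module.Structures using (IsLeftModule)
open import Algebra.Module.Morphism.Structures using (module LeftModuleMorphisms)
open import Algebra.Morphism.Structures using (module RingMorphisms)
import Algebra.Morphism.Construct.Composition as Compose
import Algebra.Morphism.Construct.Identity as Identity
import Algebra.Properties.CommutativeMonoid.Sum as Sum
import Algebra.Properties.Group as GroupProperties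
import Algebra.Properties.Ring as RingProperties
import Algebra.Properties.Semiring.Exp as Exp
open import Algebra.Structures using (IsAbelianGroup)
open import Data.Fin.Base using (Fin; zero; suc)
open import Data.Integer.Base as ℤ using (ℤ)
import Data.Integer.Properties as ℤₚ
import Data.Integer.Divisibility.Signed as ℤ∣
open import Data.Integer.Tactic.RingSolver using (solve-∀)
open import Data.List.Base using (List; []; _∷_; _++_; map)
open import Data.List.Relation.Unary.All as All using (All)
import Data.List.Relation.Unary.All.Properties as All
open import Data.Nat.Base as ℕ using (ℕ; zero; suc)
open import Data.Product.Base using (Σ; Σ-syntax; _×_; _,_; proj₁; proj₂)
open import Data.Unit.Polymorphic.Base using (⊤; tt)
import Data.Vec.Base as Vec
open Vec using (Vec; []; _∷_; removeAt)
open import Data.Vec.Functional using (Vector)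
open import Data.Vec.Relation.Binary.Pointwise.Inductive as Pw using (Pointwise; []; _∷_)
open import Function.Base using (_∘_; id)
open import Function.Bundles using (Bijection)
open import Function.Definitions using (Injective; Bijective)
open import Relation.Binary.Core using (Rel)
open import Relation.Binary.Structures using (IsEquivalence)
open import Relation.Binary.PropositionalEquality as ≡ using (_≡_; refl; cong; sym)
import Relation.Binary.Reasoning.Setoid as ≈-Reasoning
open import Relation.Nullary.Negation using (¬_)
open import Relation.Unary using (Pred)

-- 𝔽 p is the prime field, as ℤ with congruence modulo p.

module _ (p : ℕ) where

  private
    _≈_ : Rel ℤ 0ℓ
    x ≈ y = ℤ.+ p ℤ∣.∣ (x ℤ.- y)

    ≡⇒≈ : ∀ {x y} → x ≡ y → x ≈ y
    ≡⇒≈ {x} refl = ≡.subst (ℤ.+ p ℤ∣.∣_) (sym (ℤₚ.+-inverseʳ x)) (ℤ∣.divides ℤ.0ℤ refl)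

    ≈-sym : ∀ {x y} → x ≈ y → y ≈ x
    ≈-sym {x} {y} d = ≡.subst (ℤ.+ p ℤ∣.∣_) (lemma x y) (ℤ∣.∣m⇒∣-m d)
      where lemma : ∀ x y → ℤ.- (x ℤ.- y) ≡ y ℤ.- x
            lemma = solve-∀

    ≈-trans : ∀ {x y z} → x ≈ y → y ≈ z → x ≈ z
    ≈-trans {x} {y} {z} d e = ≡.subst (ℤ.+ p ℤ∣.∣_) (lemma x y z) (ℤ∣.∣m∣n⇒∣m+n d e)
      where lemma : ∀ x y z → (x ℤ.- y) ℤ.+ (y ℤ.- z) ≡ x ℤ.- z
            lemma = solve-∀

    +-cong : ∀ {x y u v} → x ≈ y → u ≈ v → (x ℤ.+ u) ≈ (y ℤ.+ v)
    +-cong {x} {y} {u} {v} d e = ≡.subst (ℤ.+ p ℤ∣.∣_) (lemma x y u v) (ℤ∣.∣m∣n⇒∣m+n d e)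
      where lemma : ∀ x y u v → (x ℤ.- y) ℤ.+ (u ℤ.- v) ≡ (x ℤ.+ u) ℤ.- (y ℤ.+ v)
            lemma = solve-∀

    neg-cong : ∀ {x y} → x ≈ y → (ℤ.- x) ≈ (ℤ.- y)
    neg-cong {x} {y} d = ≡.subst (ℤ.+ p ℤ∣.∣_) (lemma x y) (ℤ∣.∣m⇒∣-m d)
      where lemma : ∀ x y → ℤ.- (x ℤ.- y) ≡ (ℤ.- x) ℤ.- (ℤ.- y)
            lemma = solve-∀

    *-cong : ∀ {x y u v} → x ≈ y → u ≈ v → (x ℤ.* u) ≈ (y ℤ.* v)
    *-cong {x} {y} {u} {v} d e = ≡.subst (ℤ.+ p ℤ∣.∣_) (lemma x y u v)
      (ℤ∣.∣m∣n⇒∣m+n (ℤ∣.∣m⇒∣m*n u d) (ℤ∣.∣n⇒∣m*n y e))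
      where lemma : ∀ x y u v → (x ℤ.- y) ℤ.* u ℤ.+ y ℤ.* (u ℤ.- v) ≡ x ℤ.* u ℤ.- y ℤ.* v
            lemma = solve-∀

  𝔽 : CommutativeRing 0ℓ 0ℓ
  𝔽 = record
    { Carrier = ℤ
    ; _≈_ = _≈_
    ; _+_ = ℤ._+_
    ; _*_ = ℤ._*_
    ; -_ = ℤ.-_
    ; 0# = ℤ.0ℤ
    ; 1# = ℤ.1ℤ
    ; isCommutativeRing = record
      { isRing = record
        { +-isAbelianGroup = record
          { isGroup = record
            { isMonoid = record
              { isSemigroup = record
                { isMagma = record
                  { isEquivalence = record
                    { refl = λ {x} → ≡⇒≈ {x} refl
                    ; sym = λ {x} {y} → ≈-sym {x} {y}
                    ; trans = λ {x} {y} {z} → ≈-trans {x} {y} {z}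
                    }
                  ; ∙-cong = λ {x} {y} {u} {v} → +-cong {x} {y} {u} {v}
                  }
                ; assoc = λ x y z → ≡⇒≈ (ℤₚ.+-assoc x y z)
                }
              ; identity = (λ x → ≡⇒≈ (ℤₚ.+-identityˡ x)) , (λ x → ≡⇒≈ (ℤₚ.+-identityʳ x))
              }
            ; inverse = (λ x → ≡⇒≈ (ℤₚ.+-inverseˡ x)) , (λ x → ≡⇒≈ (ℤₚ.+-inverseʳ x))
            ; ⁻¹-cong = λ {x} {y} → neg-cong {x} {y}
            }
          ; comm = λ x y → ≡⇒≈ (ℤₚ.+-comm x y)
          }
        ; *-cong = λ {x} {y} {u} {v} → *-cong {x} {y} {u} {v}
        ; *-assoc = λ x y z → ≡⇒≈ (ℤₚ.*-assoc x y z)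
        ; *-identity = (λ x → ≡⇒≈ (ℤₚ.*-identityˡ x)) , (λ x → ≡⇒≈ (ℤₚ.*-identityʳ x))
        ; distrib = (λ x y z → ≡⇒≈ (ℤₚ.*-distribˡ-+ x y z)) , (λ x y z → ≡⇒≈ (ℤₚ.*-distribʳ-+ x y z))
        }
      ; *-comm = λ x y → ≡⇒≈ (ℤₚ.*-comm x y)
      }
    }

module _ {r ℓr : Level} {R : Ring r ℓr} where

  private
    module R = Ring R

  module _ {m ℓm : Level} {M : Set m} (_≈_ : Rel M ℓm) (_+_ : M → M → M) (0M : M)
           (-_ : M → M) (_*_ : R.Carrier → M → M) where

    record LeftModuleLaws : Set (r ⊔ ℓr ⊔ m ⊔ ℓm) where
      field
        isEquivalence : IsEquivalence _≈_
        +-cong        : ∀ {x y u v} → x ≈ y → u ≈ v → (x + u) ≈ (y + v)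
        neg-cong      : ∀ {x y} → x ≈ y → (- x) ≈ (- y)
        +-assoc       : ∀ x y z → ((x + y) + z) ≈ (x + (y + z))
        +-comm        : ∀ x y → (x + y) ≈ (y + x)
        +-identityˡ   : ∀ x → (0M + x) ≈ x
        +-inverseˡ    : ∀ x → ((- x) + x) ≈ 0M
        *-cong        : ∀ {a b x y} → a R.≈ b → x ≈ y → (a * x) ≈ (b * y)
        *-distribʳ    : ∀ x a b → ((a R.+ b) * x) ≈ ((a * x) + (b * x))
        *-distribˡ    : ∀ a x y → (a * (x + y)) ≈ ((a * x) + (a * y))
        *-identityˡ   : ∀ x → (R.1# * x) ≈ x
        *-assoc       : ∀ a b x → ((a R.* b) * x) ≈ (a * (b * x))

      private
        module E = IsEquivalence isEquivalence

        +-isAbelianGroup : IsAbelianGroup _≈_ _+_ 0M -_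
        +-isAbelianGroup = record
          { isGroup = record
            { isMonoid = record
              { isSemigroup = record
                { isMagma = record { isEquivalence = isEquivalence ; ∙-cong = +-cong }
                ; assoc = +-assoc
                }
              ; identity = +-identityˡ , λ x → E.trans (+-comm x 0M) (+-identityˡ x)
              }
            ; inverse = +-inverseˡ , λ x → E.trans (+-comm x (- x)) (+-inverseˡ x)
            ; ⁻¹-cong = neg-cong
            }
          ; comm = +-comm
          }

        group : Group m ℓm
        group = record { isGroup = IsAbelianGroup.isGroup +-isAbelianGroup }

        idempotent⇒0 : ∀ x → x ≈ (x + x) → x ≈ 0M
        idempotent⇒0 x e =
          E.trans (E.sym (+-identityˡ x))
          (E.trans (+-cong (E.sym (+-inverseˡ x)) E.refl)
          (E.trans (+-assoc (- x) x x)
          (E.trans (+-cong E.refl (E.sym e)) (+-inverseˡ x))))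

      isLeftModule : IsLeftModule R _≈_ _+_ 0M -_ _*_
      isLeftModule = record
        { isLeftSemimodule = record
          { +ᴹ-isCommutativeMonoid = IsAbelianGroup.isCommutativeMonoid +-isAbelianGroup
          ; isPreleftSemimodule = record
            { *ₗ-cong = *-cong
            ; *ₗ-zeroˡ = λ x → idempotent⇒0 (R.0# * x)
                (E.trans (*-cong (R.sym (R.+-identityˡ R.0#)) E.refl) (*-distribʳ x R.0# R.0#))
            ; *ₗ-distribʳ = *-distribʳ
            ; *ₗ-identityˡ = *-identityˡ
            ; *ₗ-assoc = *-assoc
            ; *ₗ-zeroʳ = λ a → idempotent⇒0 (a * 0M)
                (E.trans (*-cong R.refl (E.sym (+-identityˡ 0M))) (*-distribˡ a 0M 0M))
            ; *ₗ-distribˡ = *-distribˡ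
            }
          }
        ; -ᴹ‿cong = neg-cong
        ; -ᴹ‿inverse = IsAbelianGroup.inverse +-isAbelianGroup
        }

    leftModule : LeftModuleLaws → LeftModule R m ℓm
    leftModule laws = record { isLeftModule = LeftModuleLaws.isLeftModule laws }

  module _ {m ℓm : Level} (M : LeftModule R m ℓm) where

    private
      module M = LeftModule M
      open M using (Carrierᴹ; _≈ᴹ_; _+ᴹ_; _*ₗ_; 0ᴹ; -ᴹ_)
      open GroupProperties M.+ᴹ-group using (inverseˡ-unique)

    record Subspace (s : Level) : Set (r ⊔ m ⊔ ℓm ⊔ lsuc s) where
      field
        _∋_   : Pred Carrierᴹ s
        resp  : ∀ {x y} → x ≈ᴹ y → _∋_ x → _∋_ y
        0∈    : _∋_ 0ᴹ
        +∈    : ∀ {x y} → _∋_ x → _∋_ y → _∋_ (x +ᴹ y)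
        *∈    : ∀ a {x} → _∋_ x → _∋_ (a *ₗ x)

      -∈ : ∀ {x} → _∋_ x → _∋_ (-ᴹ x)
      -∈ {x} x∈ = resp (inverseˡ-unique (a *ₗ x) x eq) (*∈ a x∈)
        where
        a = R.- R.1#
        eq : a *ₗ x +ᴹ x ≈ᴹ 0ᴹ
        eq = M.≈ᴹ-trans (M.+ᴹ-congˡ (M.≈ᴹ-sym (M.*ₗ-identityˡ x)))
             (M.≈ᴹ-trans (M.≈ᴹ-sym (M.*ₗ-distribʳ x a R.1#))
             (M.≈ᴹ-trans (M.*ₗ-congʳ (R.-‿inverseˡ R.1#)) (M.*ₗ-zeroˡ x)))

    whole : (s : Level) → Subspace s
    whole s = record
      { _∋_ = λ _ → ⊤ ; resp = λ _ _ → tt ; 0∈ = tt ; +∈ = λ _ _ → tt ; *∈ = λ _ _ → tt }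

    -- Used for vector spaces, where being spanned by finitely many vectors is finite-dimensionality; no
    -- basis is required, since equality in M need not be decidable.

    FiniteDimensional : Set (r ⊔ m ⊔ ℓm)
    FiniteDimensional =
      Σ[ n ∈ ℕ ] Σ[ v ∈ Vector Carrierᴹ n ]
        (∀ x → Σ[ c ∈ Vector R.Carrier n ] x ≈ᴹ sum (λ i → c i *ₗ v i))
      where open Sum M.+ᴹ-commutativeMonoid using (sum)

    module _ {s : Level} (N : Subspace s) where
      open Subspace N

      submodule : LeftModule R (m ⊔ s) ℓm
      submodule = leftModule
        (λ (x y : Σ Carrierᴹ _∋_) → proj₁ x ≈ᴹ proj₁ y)
        (λ x y → proj₁ x +ᴹ proj₁ y , +∈ (proj₂ x) (proj₂ y))
        (0ᴹ , 0∈)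
        (λ x → -ᴹ proj₁ x , -∈ (proj₂ x))
        (λ a x → a *ₗ proj₁ x , *∈ a (proj₂ x))
        (record
          { isEquivalence = record { refl = M.≈ᴹ-refl ; sym = M.≈ᴹ-sym ; trans = M.≈ᴹ-trans }
          ; +-cong = M.+ᴹ-cong
          ; neg-cong = M.-ᴹ‿cong
          ; +-assoc = λ x y z → M.+ᴹ-assoc (proj₁ x) (proj₁ y) (proj₁ z)
          ; +-comm = λ x y → M.+ᴹ-comm (proj₁ x) (proj₁ y)
          ; +-identityˡ = λ x → M.+ᴹ-identityˡ (proj₁ x)
          ; +-inverseˡ = λ x → M.-ᴹ‿inverseˡ (proj₁ x)
          ; *-cong = M.*ₗ-cong
          ; *-distribʳ = λ x → M.*ₗ-distribʳ (proj₁ x)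
          ; *-distribˡ = λ a x y → M.*ₗ-distribˡ a (proj₁ x) (proj₁ y)
          ; *-identityˡ = λ x → M.*ₗ-identityˡ (proj₁ x)
          ; *-assoc = λ a b x → M.*ₗ-assoc a b (proj₁ x)
          })

      private
        _~_ : Rel Carrierᴹ s
        x ~ y = _∋_ (x +ᴹ -ᴹ y)

        open GroupProperties M.+ᴹ-group
          using (⁻¹-anti-homo-∙; ⁻¹-involutive; x≈y⇒x∙y⁻¹≈ε)
        open Sum M.+ᴹ-commutativeMonoid using (sum)
        open ≈-Reasoning M.≈ᴹ-setoid

        ≈⇒~ : ∀ {x y} → x ≈ᴹ y → x ~ y
        ≈⇒~ e = resp (M.≈ᴹ-sym (x≈y⇒x∙y⁻¹≈ε e)) 0∈

        interchange : ∀ a b c d → (a +ᴹ b) +ᴹ (c +ᴹ d) ≈ᴹ (a +ᴹ c) +ᴹ (b +ᴹ d)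
        interchange a b c d = begin
          (a +ᴹ b) +ᴹ (c +ᴹ d)  ≈⟨ M.+ᴹ-assoc a b (c +ᴹ d) ⟩
          a +ᴹ (b +ᴹ (c +ᴹ d))  ≈⟨ M.+ᴹ-congˡ (M.+ᴹ-assoc b c d) ⟨
          a +ᴹ ((b +ᴹ c) +ᴹ d)  ≈⟨ M.+ᴹ-congˡ (M.+ᴹ-congʳ (M.+ᴹ-comm b c)) ⟩
          a +ᴹ ((c +ᴹ b) +ᴹ d)  ≈⟨ M.+ᴹ-congˡ (M.+ᴹ-assoc c b d) ⟩
          a +ᴹ (c +ᴹ (b +ᴹ d))  ≈⟨ M.+ᴹ-assoc a c (b +ᴹ d) ⟨
          (a +ᴹ c) +ᴹ (b +ᴹ d)  ∎

        neg-+ : ∀ x y → -ᴹ (x +ᴹ y) ≈ᴹ -ᴹ x +ᴹ -ᴹ y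
        neg-+ x y = M.≈ᴹ-trans (⁻¹-anti-homo-∙ x y) (M.+ᴹ-comm (-ᴹ y) (-ᴹ x))

        *-neg : ∀ a x → a *ₗ -ᴹ x ≈ᴹ -ᴹ (a *ₗ x)
        *-neg a x = inverseˡ-unique _ _
          (M.≈ᴹ-trans (M.≈ᴹ-sym (M.*ₗ-distribˡ a (-ᴹ x) x))
          (M.≈ᴹ-trans (M.*ₗ-congˡ (M.-ᴹ‿inverseˡ x)) (M.*ₗ-zeroʳ a)))

        ~-sym : ∀ {x y} → x ~ y → y ~ x
        ~-sym {x} {y} d = resp (begin
          -ᴹ (x +ᴹ -ᴹ y)      ≈⟨ ⁻¹-anti-homo-∙ x (-ᴹ y) ⟩
          -ᴹ (-ᴹ y) +ᴹ -ᴹ x   ≈⟨ M.+ᴹ-congʳ (⁻¹-involutive y) ⟩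
          y +ᴹ -ᴹ x           ∎) (-∈ d)

        ~-trans : ∀ {x y z} → x ~ y → y ~ z → x ~ z
        ~-trans {x} {y} {z} d e = resp (begin
          (x +ᴹ -ᴹ y) +ᴹ (y +ᴹ -ᴹ z)  ≈⟨ M.+ᴹ-assoc x (-ᴹ y) (y +ᴹ -ᴹ z) ⟩
          x +ᴹ (-ᴹ y +ᴹ (y +ᴹ -ᴹ z))  ≈⟨ M.+ᴹ-congˡ (M.+ᴹ-assoc (-ᴹ y) y (-ᴹ z)) ⟨
          x +ᴹ ((-ᴹ y +ᴹ y) +ᴹ -ᴹ z)  ≈⟨ M.+ᴹ-congˡ (M.+ᴹ-congʳ (M.-ᴹ‿inverseˡ y)) ⟩
          x +ᴹ (0ᴹ +ᴹ -ᴹ z)           ≈⟨ M.+ᴹ-congˡ (M.+ᴹ-identityˡ (-ᴹ z)) ⟩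
          x +ᴹ -ᴹ z                   ∎) (+∈ d e)

        ~-+ : ∀ {x y u v} → x ~ y → u ~ v → (x +ᴹ u) ~ (y +ᴹ v)
        ~-+ {x} {y} {u} {v} d e = resp (begin
          (x +ᴹ -ᴹ y) +ᴹ (u +ᴹ -ᴹ v)  ≈⟨ interchange x (-ᴹ y) u (-ᴹ v) ⟩
          (x +ᴹ u) +ᴹ (-ᴹ y +ᴹ -ᴹ v)  ≈⟨ M.+ᴹ-congˡ (neg-+ y v) ⟨
          (x +ᴹ u) +ᴹ -ᴹ (y +ᴹ v)     ∎) (+∈ d e)

        ~-* : ∀ a {x y} → x ~ y → (a *ₗ x) ~ (a *ₗ y)
        ~-* a {x} {y} d = resp (begin
          a *ₗ (x +ᴹ -ᴹ y)         ≈⟨ M.*ₗ-distribˡ a x (-ᴹ y) ⟩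
          a *ₗ x +ᴹ a *ₗ -ᴹ y      ≈⟨ M.+ᴹ-congˡ (*-neg a y) ⟩
          a *ₗ x +ᴹ -ᴹ (a *ₗ y)    ∎) (*∈ a d)

      quotient : LeftModule R m s
      quotient = leftModule _~_ _+ᴹ_ 0ᴹ -ᴹ_ _*ₗ_
        (record
          { isEquivalence = record { refl = ≈⇒~ M.≈ᴹ-refl ; sym = ~-sym ; trans = ~-trans }
          ; +-cong = ~-+
          ; neg-cong = λ {x} {y} d → resp (neg-+ x (-ᴹ y)) (-∈ d)
          ; +-assoc = λ x y z → ≈⇒~ (M.+ᴹ-assoc x y z)
          ; +-comm = λ x y → ≈⇒~ (M.+ᴹ-comm x y)
          ; +-identityˡ = λ x → ≈⇒~ (M.+ᴹ-identityˡ x)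
          ; +-inverseˡ = λ x → ≈⇒~ (M.-ᴹ‿inverseˡ x)
          ; *-cong = λ {a} {b} {x} {y} e d → ~-trans (~-* a d) (≈⇒~ (M.*ₗ-congʳ e))
          ; *-distribʳ = λ x a b → ≈⇒~ (M.*ₗ-distribʳ x a b)
          ; *-distribˡ = λ a x y → ≈⇒~ (M.*ₗ-distribˡ a x y)
          ; *-identityˡ = λ x → ≈⇒~ (M.*ₗ-identityˡ x)
          ; *-assoc = λ a b x → ≈⇒~ (M.*ₗ-assoc a b x)
          })

      quotient-≈ : ∀ {x y} → x ≈ᴹ y → LeftModule._≈ᴹ_ quotient x y
      quotient-≈ = ≈⇒~

  open Subspace public using (_∋_)

  infix 4 _⊆ₛ_

  _⊆ₛ_ : {m ℓm s t : Level} {M : LeftModule R m ℓm} → Subspace M s → Subspace M t → Set (m ⊔ s ⊔ t)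
  N ⊆ₛ P = ∀ {x} → N ∋ x → P ∋ x

-- m ∔ n ≐ l says that m + n = l.  Unlike the equation, it determines m, n and l by unification.

data _∔_≐_ : ℕ → ℕ → ℕ → Set where
  zero : ∀ {n} → 0 ∔ n ≐ n
  suc  : ∀ {m n l} → m ∔ n ≐ l → suc m ∔ n ≐ suc l

∔-1 : ∀ n → n ∔ 1 ≐ suc n
∔-1 zero    = zero
∔-1 (suc n) = suc (∔-1 n)

∔-suc : ∀ {m n l} → m ∔ n ≐ l → m ∔ suc n ≐ suc l
∔-suc zero    = zero
∔-suc (suc e) = suc (∔-suc e)

-- A = ⨁ₙ Aₙ is represented by the family of its homogeneous components, so elements are homogeneous
-- elements and graded subobjects are families of subspaces.  The product Aₘ × Aₙ → Aₗ takes a proof of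
-- m + n = l, which keeps transports along equations of degrees out of the laws.

record GradedAlgebra (k : CommutativeRing 0ℓ 0ℓ) (a : Level) : Set (lsuc a) where
  private
    module k = CommutativeRing k
  field
    component : ℕ → LeftModule k.ring a a

  module C (n : ℕ) = LeftModule (component n)

  ∣_∣ : ℕ → Set a
  ∣ n ∣ = C.Carrierᴹ n

  infix 4 _≈_
  infixl 6 _+_
  infixr 7 _*ₗ_

  _≈_ : ∀ {n} → Rel ∣ n ∣ a
  _≈_ {n} = C._≈ᴹ_ n

  _+_ : ∀ {n} → ∣ n ∣ → ∣ n ∣ → ∣ n ∣
  _+_ {n} = C._+ᴹ_ n

  _*ₗ_ : ∀ {n} → k.Carrier → ∣ n ∣ → ∣ n ∣
  _*ₗ_ {n} = C._*ₗ_ n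

  0# : ∀ {n} → ∣ n ∣
  0# {n} = C.0ᴹ n

  field
    mul : ∀ {m n l} → m ∔ n ≐ l → ∣ m ∣ → ∣ n ∣ → ∣ l ∣
    1#  : ∣ 0 ∣

    mul-cong : ∀ {m n l} (e : m ∔ n ≐ l) {x y : ∣ m ∣} {u v : ∣ n ∣} → x ≈ y → u ≈ v → mul e x u ≈ mul e y v
    distribˡ : ∀ {m n l} (e : m ∔ n ≐ l) (x : ∣ m ∣) (y z : ∣ n ∣) → mul e x (y + z) ≈ mul e x y + mul e x z
    distribʳ : ∀ {m n l} (e : m ∔ n ≐ l) (x : ∣ n ∣) (y z : ∣ m ∣) → mul e (y + z) x ≈ mul e y x + mul e z x
    *ₗ-mul   : ∀ {m n l} (e : m ∔ n ≐ l) c (x : ∣ m ∣) (y : ∣ n ∣) → mul e (c *ₗ x) y ≈ c *ₗ mul e x y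
    mul-*ₗ   : ∀ {m n l} (e : m ∔ n ≐ l) c (x : ∣ m ∣) (y : ∣ n ∣) → mul e x (c *ₗ y) ≈ c *ₗ mul e x y

    identityˡ : ∀ {n} (e : 0 ∔ n ≐ n) (x : ∣ n ∣) → mul e 1# x ≈ x
    identityʳ : ∀ {n} (e : n ∔ 0 ≐ n) (x : ∣ n ∣) → mul e x 1# ≈ x
    assoc     : ∀ {i j l ij jl ijl} (e : i ∔ j ≐ ij) (f : ij ∔ l ≐ ijl) (g : j ∔ l ≐ jl)
                  (h : i ∔ jl ≐ ijl) (x : ∣ i ∣) (y : ∣ j ∣) (z : ∣ l ∣) →
                mul f (mul e x y) z ≈ mul h x (mul g y z)

  module _ {n : ℕ} where
    open C n public using ()
      renaming (≈ᴹ-refl to ≈-refl; ≈ᴹ-sym to ≈-sym; ≈ᴹ-trans to ≈-trans; -ᴹ_ to infixr 8 -_)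

module _ {k : CommutativeRing 0ℓ 0ℓ} where

  private
    module k = CommutativeRing k

  module _ {a b : Level} (A : GradedAlgebra k a) (B : GradedAlgebra k b) where

    private
      module A = GradedAlgebra A
      module B = GradedAlgebra B

    record GradedHom : Set (a ⊔ b) where
      field
        ⟦_⟧ : ∀ {n} → A.∣ n ∣ → B.∣ n ∣
        isLeftModuleHomomorphism : ∀ n →
          LeftModuleMorphisms.IsLeftModuleHomomorphism (A.C.rawLeftModule n) (B.C.rawLeftModule n) ⟦_⟧
        homo   : ∀ {m n l} (e : m ∔ n ≐ l) (x : A.∣ m ∣) (y : A.∣ n ∣) → ⟦ A.mul e x y ⟧ B.≈ B.mul e ⟦ x ⟧ ⟦ y ⟧
        1-homo : ⟦ A.1# ⟧ B.≈ B.1#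

    open GradedHom

    IsEmbedding : GradedHom → Set (a ⊔ b)
    IsEmbedding f = ∀ n → Injective (A._≈_ {n}) (B._≈_ {n}) ⟦ f ⟧

    IsIsomorphism : GradedHom → Set (a ⊔ b)
    IsIsomorphism f = ∀ n → Bijective (A._≈_ {n}) (B._≈_ {n}) ⟦ f ⟧

  open GradedHom public using (⟦_⟧)

  infix 4 _≅_ _↪_

  _≅_ : {a b : Level} → GradedAlgebra k a → GradedAlgebra k b → Set (a ⊔ b)
  A ≅ B = Σ (GradedHom A B) (IsIsomorphism A B)

  _↪_ : {a b : Level} → GradedAlgebra k a → GradedAlgebra k b → Set (a ⊔ b)
  A ↪ B = Σ (GradedHom A B) (IsEmbedding A B)

  -- A₀ = k: the unit map c ↦ c·1 is bijective.

  Connected : {a : Level} → GradedAlgebra k a → Set a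
  Connected A = Bijective k._≈_ (A._≈_ {0}) (A._*ₗ A.1#)
    where module A = GradedAlgebra A

  FiniteType : {a : Level} → GradedAlgebra k a → Set a
  FiniteType A = FiniteDimensional (GradedAlgebra.component A 1)

  Π : {a : Level} {s : ℕ} → (Fin s → GradedAlgebra k a) → GradedAlgebra k a
  Π {a} {s} A = record
    { component = λ n → leftModule
        (λ (x y : ∀ v → A.∣_∣ v n) → ∀ v → A._≈_ v (x v) (y v))
        (λ x y v → A._+_ v (x v) (y v))
        (λ v → A.0# v)
        (λ x v → A.-_ v (x v))
        (λ c x v → A._*ₗ_ v c (x v))
        (record
          { isEquivalence = record
            { refl = λ v → A.≈-refl v ; sym = λ d v → A.≈-sym v (d v) ; trans = λ d e v → A.≈-trans v (d v) (e v) }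
          ; +-cong = λ d e v → A.C.+ᴹ-cong v n (d v) (e v)
          ; neg-cong = λ d v → A.C.-ᴹ‿cong v n (d v)
          ; +-assoc = λ x y z v → A.C.+ᴹ-assoc v n (x v) (y v) (z v)
          ; +-comm = λ x y v → A.C.+ᴹ-comm v n (x v) (y v)
          ; +-identityˡ = λ x v → A.C.+ᴹ-identityˡ v n (x v)
          ; +-inverseˡ = λ x v → A.C.-ᴹ‿inverseˡ v n (x v)
          ; *-cong = λ d e v → A.C.*ₗ-cong v n d (e v)
          ; *-distribʳ = λ x c d v → A.C.*ₗ-distribʳ v n (x v) c d
          ; *-distribˡ = λ c x y v → A.C.*ₗ-distribˡ v n c (x v) (y v)
          ; *-identityˡ = λ x v → A.C.*ₗ-identityˡ v n (x v)
          ; *-assoc = λ c d x v → A.C.*ₗ-assoc v n c d (x v)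
          })
    ; mul = λ e x y v → A.mul v e (x v) (y v)
    ; 1# = λ v → A.1# v
    ; mul-cong = λ e d d′ v → A.mul-cong v e (d v) (d′ v)
    ; distribˡ = λ e x y z v → A.distribˡ v e (x v) (y v) (z v)
    ; distribʳ = λ e x y z v → A.distribʳ v e (x v) (y v) (z v)
    ; *ₗ-mul = λ e c x y v → A.*ₗ-mul v e c (x v) (y v)
    ; mul-*ₗ = λ e c x y v → A.mul-*ₗ v e c (x v) (y v)
    ; identityˡ = λ e x v → A.identityˡ v e (x v)
    ; identityʳ = λ e x v → A.identityʳ v e (x v)
    ; assoc = λ e f g h x y z v → A.assoc v e f g h (x v) (y v) (z v)
    }
    where module A (v : Fin s) = GradedAlgebra (A v)

  module _ {a : Level} (A : GradedAlgebra k a) where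

    open GradedAlgebra A

    record Subalgebra : Set (lsuc a) where
      field
        part : ∀ n → Subspace (component n) a
        1∈   : part 0 ∋ 1#
        mul∈ : ∀ {m n l} (e : m ∔ n ≐ l) {x : ∣ m ∣} {y : ∣ n ∣} → part m ∋ x → part n ∋ y → part l ∋ mul e x y

  module _ {a : Level} {A : GradedAlgebra k a} where

    open GradedAlgebra A
    open Subalgebra

    infix 4 _≤_

    _≤_ : Subalgebra A → Subalgebra A → Set a
    B ≤ B′ = ∀ n → part B n ⊆ₛ part B′ n

    ⌞_⌟ : Subalgebra A → GradedAlgebra k a
    ⌞ B ⌟ = record
      { component = λ n → submodule (component n) (part B n)
      ; mul = λ e x y → mul e (proj₁ x) (proj₁ y) , mul∈ B e (proj₂ x) (proj₂ y)
      ; 1# = 1# , 1∈ B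
      ; mul-cong = λ e {x} {y} {u} {v} d d′ → mul-cong e {proj₁ x} {proj₁ y} {proj₁ u} {proj₁ v} d d′
      ; distribˡ = λ e x y z → distribˡ e (proj₁ x) (proj₁ y) (proj₁ z)
      ; distribʳ = λ e x y z → distribʳ e (proj₁ x) (proj₁ y) (proj₁ z)
      ; *ₗ-mul = λ e c x y → *ₗ-mul e c (proj₁ x) (proj₁ y)
      ; mul-*ₗ = λ e c x y → mul-*ₗ e c (proj₁ x) (proj₁ y)
      ; identityˡ = λ e x → identityˡ e (proj₁ x)
      ; identityʳ = λ e x → identityʳ e (proj₁ x)
      ; assoc = λ e f g h x y z → assoc e f g h (proj₁ x) (proj₁ y) (proj₁ z)
      }

  module _ {a : Level} (A : GradedAlgebra k a) where

    open GradedAlgebra A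

    module _ (W : Subspace (component 1) a) where

      data Generated : ∀ {n} → Pred ∣ n ∣ a where
        gen   : ∀ {x} → W ∋ x → Generated x
        one   : Generated 1#
        mult  : ∀ {m n l} (e : m ∔ n ≐ l) {x : ∣ m ∣} {y : ∣ n ∣} → Generated x → Generated y → Generated (mul e x y)
        null  : ∀ {n} → Generated (0# {n})
        plus  : ∀ {n} {x y : ∣ n ∣} → Generated x → Generated y → Generated (x + y)
        scale : ∀ {n} c {x : ∣ n ∣} → Generated x → Generated (c *ₗ x)
        equal : ∀ {n} {x y : ∣ n ∣} → x ≈ y → Generated x → Generated y

      infix 5 _⟨_⟩

      _⟨_⟩ : Subalgebra A
      _⟨_⟩ = record
        { part = λ n → record { _∋_ = Generated ; resp = equal ; 0∈ = null ; +∈ = plus ; *∈ = scale }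
        ; 1∈ = one
        ; mul∈ = mult
        }

    GeneratedInDegree1 : Set a
    GeneratedInDegree1 = ∀ n (x : ∣ n ∣) → Subalgebra.part (_⟨_⟩ (whole (component 1) a)) n ∋ x

  module _ {a : Level} {A B : GradedAlgebra k a} (f : GradedHom A B) where

    private
      module A = GradedAlgebra A
      module B = GradedAlgebra B
      module f n = LeftModuleMorphisms.IsLeftModuleHomomorphism (GradedHom.isLeftModuleHomomorphism f n)

    image : Subalgebra A → Subalgebra B
    image C = record
      { part = λ n → record
        { _∋_ = λ y → Σ[ x ∈ A.∣ n ∣ ] part n ∋ x × ⟦ f ⟧ x B.≈ y
        ; resp = λ { e (x , x∈ , d) → x , x∈ , B.≈-trans d e }
        ; 0∈ = A.0# , Subspace.0∈ (part n) , f.0ᴹ-homo n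
        ; +∈ = λ { (x , x∈ , d) (y , y∈ , e) → x A.+ y , Subspace.+∈ (part n) x∈ y∈ ,
                   B.≈-trans (f.+ᴹ-homo n x y) (B.C.+ᴹ-cong n d e) }
        ; *∈ = λ { c (x , x∈ , d) → c A.*ₗ x , Subspace.*∈ (part n) c x∈ ,
                   B.≈-trans (f.*ₗ-homo n c x) (B.C.*ₗ-congˡ n d) }
        }
      ; 1∈ = A.1# , 1∈ , GradedHom.1-homo f
      ; mul∈ = λ { e (x , x∈ , d) (y , y∈ , d′) → A.mul e x y , mul∈ e x∈ y∈ ,
                   B.≈-trans (GradedHom.homo f e x y) (B.mul-cong e d d′) }
      }
      where open Subalgebra C

  module _ {a : Level} (A : GradedAlgebra k a) where

    open GradedAlgebra A

    record Ideal : Set (lsuc a) where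
      field
        part  : ∀ n → Subspace (component n) a
        mulˡ∈ : ∀ {m n l} (e : m ∔ n ≐ l) (x : ∣ m ∣) {y : ∣ n ∣} → part n ∋ y → part l ∋ mul e x y
        mulʳ∈ : ∀ {m n l} (e : m ∔ n ≐ l) {x : ∣ m ∣} (y : ∣ n ∣) → part m ∋ x → part l ∋ mul e x y

    infix 5 _/_

    _/_ : Ideal → GradedAlgebra k a
    _/_ I = record
      { component = λ n → quotient (component n) (part n)
      ; mul = mul
      ; 1# = 1#
      ; mul-cong = λ {m} {n} {l} e {x} {y} {u} {v} d d′ → Subspace.resp (part l)
          (difference e x y u v) (Subspace.+∈ (part l) (mulʳ∈ e u d) (mulˡ∈ e y d′))
      ; distribˡ = λ {m} {n} {l} e x y z → ≈⇒ l (distribˡ e x y z)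
      ; distribʳ = λ {m} {n} {l} e x y z → ≈⇒ l (distribʳ e x y z)
      ; *ₗ-mul = λ {m} {n} {l} e c x y → ≈⇒ l (*ₗ-mul e c x y)
      ; mul-*ₗ = λ {m} {n} {l} e c x y → ≈⇒ l (mul-*ₗ e c x y)
      ; identityˡ = λ {n} e x → ≈⇒ n (identityˡ e x)
      ; identityʳ = λ {n} e x → ≈⇒ n (identityʳ e x)
      ; assoc = λ {i} {j} {l} {ij} {jl} {ijl} e f g h x y z → ≈⇒ ijl (assoc e f g h x y z)
      }
      where
      open Ideal I

      ≈⇒ : ∀ n {x y : ∣ n ∣} → x ≈ y → LeftModule._≈ᴹ_ (quotient (component n) (part n)) x y
      ≈⇒ n = quotient-≈ (component n) (part n)

      neg-mulˡ : ∀ {m n l} (e : m ∔ n ≐ l) (x : ∣ m ∣) (y : ∣ n ∣) → mul e (- x) y ≈ - mul e x y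
      neg-mulˡ {m} {n} {l} e x y = GroupProperties.inverseˡ-unique (C.+ᴹ-group l) _ _
        (≈-trans (≈-sym (distribʳ e y (- x) x))
        (≈-trans (mul-cong e (≈-trans (C.-ᴹ‿inverseˡ m x) (≈-sym (C.*ₗ-zeroˡ m x))) ≈-refl)
        (≈-trans (*ₗ-mul e k.0# x y) (C.*ₗ-zeroˡ l _))))

      neg-mulʳ : ∀ {m n l} (e : m ∔ n ≐ l) (x : ∣ m ∣) (y : ∣ n ∣) → mul e x (- y) ≈ - mul e x y
      neg-mulʳ {m} {n} {l} e x y = GroupProperties.inverseˡ-unique (C.+ᴹ-group l) _ _
        (≈-trans (≈-sym (distribˡ e x (- y) y))
        (≈-trans (mul-cong e ≈-refl (≈-trans (C.-ᴹ‿inverseˡ n y) (≈-sym (C.*ₗ-zeroˡ n y))))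
        (≈-trans (mul-*ₗ e k.0# x y) (C.*ₗ-zeroˡ l _))))

      difference : ∀ {m n l} (e : m ∔ n ≐ l) (x y : ∣ m ∣) (u v : ∣ n ∣) →
                   mul e (x + - y) u + mul e y (u + - v) ≈ mul e x u + - mul e y v
      difference {l = l} e x y u v = begin
        mul e (x + - y) u + mul e y (u + - v)                      ≈⟨ C.+ᴹ-cong l (distribʳ e u x (- y)) (distribˡ e y u (- v)) ⟩
        (mul e x u + mul e (- y) u) + (mul e y u + mul e y (- v))  ≈⟨ C.+ᴹ-assoc l _ _ _ ⟩
        mul e x u + (mul e (- y) u + (mul e y u + mul e y (- v)))  ≈⟨ C.+ᴹ-congˡ l (C.+ᴹ-assoc l _ _ _) ⟨
        mul e x u + ((mul e (- y) u + mul e y u) + mul e y (- v))  ≈⟨ C.+ᴹ-congˡ l (C.+ᴹ-cong l (C.+ᴹ-congʳ l (neg-mulˡ e y u)) (neg-mulʳ e y v)) ⟩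
        mul e x u + ((- mul e y u + mul e y u) + - mul e y v)      ≈⟨ C.+ᴹ-congˡ l (C.+ᴹ-congʳ l (C.-ᴹ‿inverseˡ l _)) ⟩
        mul e x u + (0# + - mul e y v)                             ≈⟨ C.+ᴹ-congˡ l (C.+ᴹ-identityˡ l _) ⟩
        mul e x u + - mul e y v                                    ∎
        where open ≈-Reasoning (C.≈ᴹ-setoid l)

    module _ (R : Subspace (component 2) a) where

      data InIdeal : ∀ {n} → Pred ∣ n ∣ a where
        gen   : ∀ {x} → R ∋ x → InIdeal x
        multˡ : ∀ {m n l} (e : m ∔ n ≐ l) (x : ∣ m ∣) {y : ∣ n ∣} → InIdeal y → InIdeal (mul e x y)
        multʳ : ∀ {m n l} (e : m ∔ n ≐ l) {x : ∣ m ∣} (y : ∣ n ∣) → InIdeal x → InIdeal (mul e x y)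
        null  : ∀ {n} → InIdeal (0# {n})
        plus  : ∀ {n} {x y : ∣ n ∣} → InIdeal x → InIdeal y → InIdeal (x + y)
        scale : ∀ {n} c {x : ∣ n ∣} → InIdeal x → InIdeal (c *ₗ x)
        equal : ∀ {n} {x y : ∣ n ∣} → x ≈ y → InIdeal x → InIdeal y

      idealGeneratedBy : Ideal
      idealGeneratedBy = record
        { part = λ n → record { _∋_ = InIdeal ; resp = equal ; 0∈ = null ; +∈ = plus ; *∈ = scale }
        ; mulˡ∈ = multˡ
        ; mulʳ∈ = multʳ
        }

  -- T(V) as the free graded algebra on V placed in degree 1: formal expressions modulo the congruence
  -- generated by the algebra laws and the linearity of V → T(V).  Its degree 2 component is V ⊗ V.

  module _ {a : Level} (V : LeftModule k.ring a a) where

    private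
      module V = LeftModule V

    data Tensor : ℕ → Set a where
      gen    : V.Carrierᴹ → Tensor 1
      one  : Tensor 0
      mult : ∀ {m n l} → m ∔ n ≐ l → Tensor m → Tensor n → Tensor l
      null : ∀ {n} → Tensor n
      _⊕_  : ∀ {n} → Tensor n → Tensor n → Tensor n
      ⊖_   : ∀ {n} → Tensor n → Tensor n
      _⊙_  : ∀ {n} → k.Carrier → Tensor n → Tensor n

    infix  4 _≋_
    infixl 6 _⊕_
    infixr 7 _⊙_
    infixr 8 ⊖_

    data _≋_ : ∀ {n} → Tensor n → Tensor n → Set a where
      ≋-refl  : ∀ {n} {x : Tensor n} → x ≋ x
      ≋-sym   : ∀ {n} {x y : Tensor n} → x ≋ y → y ≋ x
      ≋-trans : ∀ {n} {x y z : Tensor n} → x ≋ y → y ≋ z → x ≋ z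

      gen-cong : ∀ {x y} → x V.≈ᴹ y → gen x ≋ gen y
      gen-+    : ∀ x y → gen (x V.+ᴹ y) ≋ gen x ⊕ gen y
      gen-*    : ∀ c x → gen (c V.*ₗ x) ≋ c ⊙ gen x

      ⊕-cong      : ∀ {n} {x y u v : Tensor n} → x ≋ y → u ≋ v → x ⊕ u ≋ y ⊕ v
      ⊖-cong      : ∀ {n} {x y : Tensor n} → x ≋ y → ⊖ x ≋ ⊖ y
      ⊕-assoc     : ∀ {n} (x y z : Tensor n) → (x ⊕ y) ⊕ z ≋ x ⊕ (y ⊕ z)
      ⊕-comm      : ∀ {n} (x y : Tensor n) → x ⊕ y ≋ y ⊕ x
      ⊕-identityˡ : ∀ {n} (x : Tensor n) → null ⊕ x ≋ x
      ⊕-inverseˡ  : ∀ {n} (x : Tensor n) → ⊖ x ⊕ x ≋ null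

      ⊙-cong      : ∀ {n} {c d} {x y : Tensor n} → c k.≈ d → x ≋ y → c ⊙ x ≋ d ⊙ y
      ⊙-distribʳ  : ∀ {n} (x : Tensor n) c d → (c k.+ d) ⊙ x ≋ c ⊙ x ⊕ d ⊙ x
      ⊙-distribˡ  : ∀ {n} c (x y : Tensor n) → c ⊙ (x ⊕ y) ≋ c ⊙ x ⊕ c ⊙ y
      ⊙-identityˡ : ∀ {n} (x : Tensor n) → k.1# ⊙ x ≋ x
      ⊙-assoc     : ∀ {n} c d (x : Tensor n) → (c k.* d) ⊙ x ≋ c ⊙ d ⊙ x

      mult-cong      : ∀ {m n l} (e : m ∔ n ≐ l) {x y : Tensor m} {u v : Tensor n} →
                       x ≋ y → u ≋ v → mult e x u ≋ mult e y v
      mult-distribˡ  : ∀ {m n l} (e : m ∔ n ≐ l) (x : Tensor m) (y z : Tensor n) →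
                       mult e x (y ⊕ z) ≋ mult e x y ⊕ mult e x z
      mult-distribʳ  : ∀ {m n l} (e : m ∔ n ≐ l) (x : Tensor n) (y z : Tensor m) →
                       mult e (y ⊕ z) x ≋ mult e y x ⊕ mult e z x
      ⊙-mult         : ∀ {m n l} (e : m ∔ n ≐ l) c (x : Tensor m) (y : Tensor n) →
                       mult e (c ⊙ x) y ≋ c ⊙ mult e x y
      mult-⊙         : ∀ {m n l} (e : m ∔ n ≐ l) c (x : Tensor m) (y : Tensor n) →
                       mult e x (c ⊙ y) ≋ c ⊙ mult e x y
      mult-identityˡ : ∀ {n} (e : 0 ∔ n ≐ n) (x : Tensor n) → mult e one x ≋ x
      mult-identityʳ : ∀ {n} (e : n ∔ 0 ≐ n) (x : Tensor n) → mult e x one ≋ x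
      mult-assoc     : ∀ {i j l ij jl ijl} (e : i ∔ j ≐ ij) (f : ij ∔ l ≐ ijl) (g : j ∔ l ≐ jl)
                         (h : i ∔ jl ≐ ijl) (x : Tensor i) (y : Tensor j) (z : Tensor l) →
                       mult f (mult e x y) z ≋ mult h x (mult g y z)

    TensorAlgebra : GradedAlgebra k a
    TensorAlgebra = record
      { component = λ n → leftModule (_≋_ {n}) _⊕_ null ⊖_ _⊙_
          (record
            { isEquivalence = record { refl = ≋-refl ; sym = ≋-sym ; trans = ≋-trans }
            ; +-cong = ⊕-cong
            ; neg-cong = ⊖-cong
            ; +-assoc = ⊕-assoc
            ; +-comm = ⊕-comm
            ; +-identityˡ = ⊕-identityˡ
            ; +-inverseˡ = ⊕-inverseˡ
            ; *-cong = ⊙-cong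
            ; *-distribʳ = ⊙-distribʳ
            ; *-distribˡ = ⊙-distribˡ
            ; *-identityˡ = ⊙-identityˡ
            ; *-assoc = ⊙-assoc
            })
      ; mul = mult
      ; 1# = one
      ; mul-cong = mult-cong
      ; distribˡ = mult-distribˡ
      ; distribʳ = mult-distribʳ
      ; *ₗ-mul = ⊙-mult
      ; mul-*ₗ = mult-⊙
      ; identityˡ = mult-identityˡ
      ; identityʳ = mult-identityʳ
      ; assoc = mult-assoc
      }

  module _ {a : Level} (A : GradedAlgebra k a) where

    open GradedAlgebra A

    record IsQuadratic : Set (lsuc a) where
      field
        connected          : Connected A
        generatedInDegree1 : GeneratedInDegree1 A
        relations          : Subspace (GradedAlgebra.component (TensorAlgebra (component 1)) 2) a
        presentation       : A ≅ TensorAlgebra (component 1) / idealGeneratedBy _ relations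

    record LeftIdeal : Set (lsuc a) where
      field
        part : ∀ n → Subspace (component n) a
        mul∈ : ∀ {m n l} (e : m ∔ n ≐ l) (x : ∣ m ∣) {y : ∣ n ∣} → part n ∋ y → part l ∋ mul e x y

    open LeftIdeal

    -- The left ideal A·I₁; scalar multiples are covered by multiplication with A₀.

    data InSpan (I₁ : Subspace (component 1) a) : ∀ {n} → Pred ∣ n ∣ a where
      mult  : ∀ {m n} (e : m ∔ 1 ≐ n) (x : ∣ m ∣) {y : ∣ 1 ∣} → I₁ ∋ y → InSpan I₁ (mul e x y)
      null  : ∀ {n} → InSpan I₁ (0# {n})
      plus  : ∀ {n} {x y : ∣ n ∣} → InSpan I₁ x → InSpan I₁ y → InSpan I₁ (x + y)
      equal : ∀ {n} {x y : ∣ n ∣} → x ≈ y → InSpan I₁ x → InSpan I₁ y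

    -- I ∈ 𝓛(A), i.e. I = A·I₁; the inclusion A·I₁ ⊆ I holds for every left ideal.

    _∈𝓛 : LeftIdeal → Set a
    I ∈𝓛 = ∀ {n} {x : ∣ n ∣} → part I n ∋ x → InSpan (part I 1) x

    -- (I : x)ₙ = {y ∈ Aₙ | yx ∈ Iₙ₊₁} for x ∈ A₁

    colon : LeftIdeal → ∣ 1 ∣ → LeftIdeal
    colon I x = record
      { part = λ n → record
        { _∋_ = λ y → part I (suc n) ∋ mul (∔-1 n) y x
        ; resp = λ d → Subspace.resp (part I (suc n)) (mul-cong (∔-1 n) d ≈-refl)
        ; 0∈ = Subspace.resp (part I (suc n)) (≈-sym (0-mul (∔-1 n) x)) (Subspace.0∈ (part I (suc n)))
        ; +∈ = λ {y} {z} y∈ z∈ → Subspace.resp (part I (suc n)) (≈-sym (distribʳ (∔-1 n) x y z))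
                 (Subspace.+∈ (part I (suc n)) y∈ z∈)
        ; *∈ = λ c {y} y∈ → Subspace.resp (part I (suc n)) (≈-sym (*ₗ-mul (∔-1 n) c y x))
                 (Subspace.*∈ (part I (suc n)) c y∈)
        }
      ; mul∈ = λ {m} {n} {l} e y {z} z∈ → Subspace.resp (part I (suc l))
          (≈-sym (assoc e (∔-1 l) (∔-1 n) (∔-suc e) y z x)) (mul∈ I (∔-suc e) y z∈)
      }
      where
      0-mul : ∀ {m n l} (e : m ∔ n ≐ l) (x : ∣ n ∣) → mul e 0# x ≈ 0#
      0-mul {m} {n} {l} e x =
        ≈-trans (mul-cong e (≈-sym (C.*ₗ-zeroˡ m 0#)) ≈-refl)
        (≈-trans (*ₗ-mul e k.0# 0# x) (C.*ₗ-zeroˡ l _))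

    record IsUniversallyKoszul : Set (lsuc a) where
      field
        isQuadratic : IsQuadratic
        finiteType  : FiniteType A
        colon∈𝓛     : ∀ I → I ∈𝓛 → ∀ x → ¬ part I 1 ∋ x → colon I x ∈𝓛

    record FilteredSystem : Set (lsuc a) where
      field
        Index     : Set a
        inhabited : Index
        member    : Index → Subalgebra A
        directed  : ∀ i j → Σ[ l ∈ Index ] member i ≤ member l × member j ≤ member l

      upper : Index → Index → Index
      upper i j = proj₁ (directed i j)

  module _ {a : Level} {A : GradedAlgebra k a} (F : FilteredSystem A) where

    open GradedAlgebra A
    open FilteredSystem F
    open Subalgebra using (part)

    private
      ⟪_⟫ : ℕ → Set a
      ⟪ n ⟫ = Σ[ i ∈ Index ] Σ[ x ∈ ∣ n ∣ ] part (member i) n ∋ x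

      value : ∀ {n} → ⟪ n ⟫ → ∣ n ∣
      value (_ , x , _) = x

      -- Equality in the colimit is equality at a common later stage.

      _~_ : ∀ {n} → Rel ⟪ n ⟫ a
      _~_ {n} (i , x , _) (j , y , _) =
        Σ[ l ∈ Index ] member i ≤ member l × member j ≤ member l × x ≈ y

      ≈⇒~ : ∀ {n} (x y : ⟪ n ⟫) → value x ≈ value y → x ~ y
      ≈⇒~ (i , _) (j , _) e = upper i j , proj₁ (proj₂ (directed i j)) , proj₂ (proj₂ (directed i j)) , e

      ~⇒≈ : ∀ {n} (x y : ⟪ n ⟫) → x ~ y → value x ≈ value y
      ~⇒≈ _ _ (_ , _ , _ , e) = e

      _⊞_ : ∀ {n} → ⟪ n ⟫ → ⟪ n ⟫ → ⟪ n ⟫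
      _⊞_ {n} (i , x , x∈) (j , y , y∈) = upper i j , x + y ,
        Subspace.+∈ (part (member (upper i j)) n)
          (proj₁ (proj₂ (directed i j)) n x∈) (proj₂ (proj₂ (directed i j)) n y∈)

      ⊟_ : ∀ {n} → ⟪ n ⟫ → ⟪ n ⟫
      ⊟_ {n} (i , x , x∈) = i , - x , Subspace.-∈ (part (member i) n) x∈

      _·_ : ∀ {n} → k.Carrier → ⟪ n ⟫ → ⟪ n ⟫
      _·_ {n} c (i , x , x∈) = i , c *ₗ x , Subspace.*∈ (part (member i) n) c x∈

      zero# : ∀ {n} → ⟪ n ⟫
      zero# {n} = inhabited , 0# , Subspace.0∈ (part (member inhabited) n)

      times : ∀ {m n l} → m ∔ n ≐ l → ⟪ m ⟫ → ⟪ n ⟫ → ⟪ l ⟫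
      times {m} {n} {l} e (i , x , x∈) (j , y , y∈) = upper i j , mul e x y ,
        Subalgebra.mul∈ (member (upper i j)) e
          (proj₁ (proj₂ (directed i j)) m x∈) (proj₂ (proj₂ (directed i j)) n y∈)

      unit : ⟪ 0 ⟫
      unit = inhabited , 1# , Subalgebra.1∈ (member inhabited)

    colimit : GradedAlgebra k a
    colimit = record
      { component = λ n → leftModule (_~_ {n}) _⊞_ zero# ⊟_ _·_
          (record
            { isEquivalence = record
              { refl = λ {x} → ≈⇒~ x x ≈-refl
              ; sym = λ {x} {y} d → ≈⇒~ y x (≈-sym (~⇒≈ x y d))
              ; trans = λ {x} {y} {z} d e → ≈⇒~ x z (≈-trans (~⇒≈ x y d) (~⇒≈ y z e))
              }
            ; +-cong = λ {x} {y} {u} {v} d e → ≈⇒~ (x ⊞ u) (y ⊞ v) (C.+ᴹ-cong n (~⇒≈ x y d) (~⇒≈ u v e))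
            ; neg-cong = λ {x} {y} d → ≈⇒~ (⊟ x) (⊟ y) (C.-ᴹ‿cong n (~⇒≈ x y d))
            ; +-assoc = λ x y z → ≈⇒~ ((x ⊞ y) ⊞ z) (x ⊞ (y ⊞ z)) (C.+ᴹ-assoc n (value x) (value y) (value z))
            ; +-comm = λ x y → ≈⇒~ (x ⊞ y) (y ⊞ x) (C.+ᴹ-comm n (value x) (value y))
            ; +-identityˡ = λ x → ≈⇒~ (zero# ⊞ x) x (C.+ᴹ-identityˡ n (value x))
            ; +-inverseˡ = λ x → ≈⇒~ ((⊟ x) ⊞ x) zero# (C.-ᴹ‿inverseˡ n (value x))
            ; *-cong = λ {c} {d} {x} {y} e f → ≈⇒~ (c · x) (d · y) (C.*ₗ-cong n e (~⇒≈ x y f))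
            ; *-distribʳ = λ x c d → ≈⇒~ ((c k.+ d) · x) ((c · x) ⊞ (d · x)) (C.*ₗ-distribʳ n (value x) c d)
            ; *-distribˡ = λ c x y → ≈⇒~ (c · (x ⊞ y)) ((c · x) ⊞ (c · y)) (C.*ₗ-distribˡ n c (value x) (value y))
            ; *-identityˡ = λ x → ≈⇒~ (k.1# · x) x (C.*ₗ-identityˡ n (value x))
            ; *-assoc = λ c d x → ≈⇒~ ((c k.* d) · x) (c · (d · x)) (C.*ₗ-assoc n c d (value x))
            })
      ; mul = times
      ; 1# = unit
      ; mul-cong = λ e {x} {y} {u} {v} d d′ →
          ≈⇒~ (times e x u) (times e y v) (mul-cong e (~⇒≈ x y d) (~⇒≈ u v d′))
      ; distribˡ = λ e x y z → ≈⇒~ (times e x (y ⊞ z)) (times e x y ⊞ times e x z)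
          (distribˡ e (value x) (value y) (value z))
      ; distribʳ = λ e x y z → ≈⇒~ (times e (y ⊞ z) x) (times e y x ⊞ times e z x)
          (distribʳ e (value x) (value y) (value z))
      ; *ₗ-mul = λ e c x y → ≈⇒~ (times e (c · x) y) (c · times e x y) (*ₗ-mul e c (value x) (value y))
      ; mul-*ₗ = λ e c x y → ≈⇒~ (times e x (c · y)) (c · times e x y) (mul-*ₗ e c (value x) (value y))
      ; identityˡ = λ e x → ≈⇒~ (times e unit x) x (identityˡ e (value x))
      ; identityʳ = λ e x → ≈⇒~ (times e x unit) x (identityʳ e (value x))
      ; assoc = λ e f g h x y z → ≈⇒~ (times f (times e x y) z) (times h x (times g y z))
          (assoc e f g h (value x) (value y) (value z))
      }

    fromColimit : GradedHom colimit A
    fromColimit = record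
      { ⟦_⟧ = value
      ; isLeftModuleHomomorphism = λ n → record
        { +ᴹ-isGroupHomomorphism = record
          { isMonoidHomomorphism = record
            { isMagmaHomomorphism = record
              { isRelHomomorphism = record { cong = λ {x} {y} → ~⇒≈ x y }
              ; homo = λ _ _ → ≈-refl
              }
            ; ε-homo = ≈-refl
            }
          ; ⁻¹-homo = λ _ → ≈-refl
          }
        ; *ₗ-homo = λ _ _ → ≈-refl
        }
      ; homo = λ _ _ _ → ≈-refl
      ; 1-homo = ≈-refl
      }

  module _ {a : Level} (A : GradedAlgebra k a) where

    open GradedAlgebra A
    open FilteredSystem
    open Subalgebra using (part)

    record IsFilteredUnionOfUniversallyKoszul : Set (lsuc a) where
      field
        system            : FilteredSystem A
        universallyKoszul : ∀ i → IsUniversallyKoszul ⌞ member system i ⌟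
        union             : ∀ n (x : ∣ n ∣) → Σ[ i ∈ Index system ] part (member system i) n ∋ x

    record IsAsymptoticallyUniversallyKoszul : Set (lsuc a) where
      field
        connected          : Connected A
        generatedInDegree1 : GeneratedInDegree1 A
        system             : FilteredSystem A
        universallyKoszul  : ∀ i → IsUniversallyKoszul ⌞ member system i ⌟
        colimit≅           : IsIsomorphism (colimit system) A (fromColimit system)
        absorbs            : ∀ (W : Subspace (component 1) a) → FiniteDimensional (submodule (component 1) W) →
                             Σ[ i ∈ Index system ] W ⊆ₛ part (member system i) 1

-- A topological group with a neighbourhood basis of the identity consisting of open subgroups
-- (for instance, any profinite group).

record NonarchimedeanGroup (g ℓ b u : Level) : Set (lsuc (g ⊔ ℓ ⊔ b ⊔ u)) where
  field
    group : Group g ℓ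

  open Group group public

  field
    Basis     : Set b
    U         : Basis → Pred Carrier u
    U-resp    : ∀ i {x y} → x ≈ y → U i x → U i y
    U-ε       : ∀ i → U i ε
    U-∙       : ∀ i {x y} → U i x → U i y → U i (x ∙ y)
    U-⁻¹      : ∀ i {x} → U i x → U i (x ⁻¹)
    U-∩       : ∀ i j → Σ[ l ∈ Basis ] (∀ {x} → U l x → U i x × U j x)
    U-conj    : ∀ i x → Σ[ j ∈ Basis ] (∀ {u} → U j u → U i (x ∙ u ∙ x ⁻¹))
    inhabited : Basis

module _ {g ℓ : Level} (G : Group g ℓ) where

  open Group G

  record NormalSubgroup (s : Level) : Set (g ⊔ ℓ ⊔ lsuc s) where
    field
      _∋ₙ_   : Pred Carrier s
      resp   : ∀ {x y} → x ≈ y → _∋ₙ_ x → _∋ₙ_ y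
      ε∈     : _∋ₙ_ ε
      ∙∈     : ∀ {x y} → _∋ₙ_ x → _∋ₙ_ y → _∋ₙ_ (x ∙ y)
      ⁻¹∈    : ∀ {x} → _∋ₙ_ x → _∋ₙ_ (x ⁻¹)
      conj∈  : ∀ x {n} → _∋ₙ_ n → _∋ₙ_ (x ∙ n ∙ x ⁻¹)

  module _ {s : Level} (N : NormalSubgroup s) where

    open NormalSubgroup N
    open GroupProperties G using (⁻¹-anti-homo-∙; ⁻¹-involutive)
    open ≈-Reasoning setoid

    private
      open module ≈ = Group G using () renaming (trans to ≈-trans; sym to ≈-sym; refl to ≈-refl)

      _~_ : Rel Carrier s
      x ~ y = _∋ₙ_ (x ⁻¹ ∙ y)

      ≈⇒~ : ∀ {x y} → x ≈ y → x ~ y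
      ≈⇒~ {x} e = resp (≈-trans (≈-sym (inverseˡ x)) (∙-congˡ e)) ε∈

      cancel : ∀ x y z → (x ⁻¹ ∙ y) ∙ (y ⁻¹ ∙ z) ≈ x ⁻¹ ∙ z
      cancel x y z = begin
        (x ⁻¹ ∙ y) ∙ (y ⁻¹ ∙ z)  ≈⟨ assoc _ _ _ ⟩
        x ⁻¹ ∙ (y ∙ (y ⁻¹ ∙ z))  ≈⟨ ∙-congˡ (assoc _ _ _) ⟨
        x ⁻¹ ∙ ((y ∙ y ⁻¹) ∙ z)  ≈⟨ ∙-congˡ (∙-congʳ (inverseʳ y)) ⟩
        x ⁻¹ ∙ (ε ∙ z)           ≈⟨ ∙-congˡ (identityˡ z) ⟩
        x ⁻¹ ∙ z                 ∎

      ~-sym : ∀ {x y} → x ~ y → y ~ x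
      ~-sym {x} {y} d = resp (≈-trans (⁻¹-anti-homo-∙ (x ⁻¹) y) (∙-congˡ (⁻¹-involutive x))) (⁻¹∈ d)

      ~-trans : ∀ {x y z} → x ~ y → y ~ z → x ~ z
      ~-trans {x} {y} {z} d e = resp (cancel x y z) (∙∈ d e)

      conj⁻¹∈ : ∀ x {n} → _∋ₙ_ n → _∋ₙ_ (x ⁻¹ ∙ n ∙ x)
      conj⁻¹∈ x d = resp (∙-congˡ (⁻¹-involutive x)) (conj∈ (x ⁻¹) d)

      ~-∙ : ∀ {x y u v} → x ~ y → u ~ v → (x ∙ u) ~ (y ∙ v)
      ~-∙ {x} {y} {u} {v} d e = resp (begin
        (u ⁻¹ ∙ (x ⁻¹ ∙ y) ∙ u) ∙ (u ⁻¹ ∙ v)  ≈⟨ assoc _ _ _ ⟩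
        (u ⁻¹ ∙ (x ⁻¹ ∙ y)) ∙ (u ∙ (u ⁻¹ ∙ v)) ≈⟨ ∙-congˡ (assoc _ _ _) ⟨
        (u ⁻¹ ∙ (x ⁻¹ ∙ y)) ∙ ((u ∙ u ⁻¹) ∙ v) ≈⟨ ∙-congˡ (∙-congʳ (inverseʳ u)) ⟩
        (u ⁻¹ ∙ (x ⁻¹ ∙ y)) ∙ (ε ∙ v)          ≈⟨ ∙-congˡ (identityˡ v) ⟩
        (u ⁻¹ ∙ (x ⁻¹ ∙ y)) ∙ v                ≈⟨ ∙-congʳ (assoc _ _ _) ⟨
        ((u ⁻¹ ∙ x ⁻¹) ∙ y) ∙ v                ≈⟨ assoc _ _ _ ⟩
        (u ⁻¹ ∙ x ⁻¹) ∙ (y ∙ v)                ≈⟨ ∙-congʳ (⁻¹-anti-homo-∙ x u) ⟨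
        (x ∙ u) ⁻¹ ∙ (y ∙ v)                   ∎) (∙∈ (conj⁻¹∈ u d) e)

      ~-⁻¹ : ∀ {x y} → x ~ y → (x ⁻¹) ~ (y ⁻¹)
      ~-⁻¹ {x} {y} d = resp (begin
        x ∙ (y ⁻¹ ∙ x) ∙ x ⁻¹    ≈⟨ assoc _ _ _ ⟩
        x ∙ ((y ⁻¹ ∙ x) ∙ x ⁻¹)  ≈⟨ ∙-congˡ (assoc _ _ _) ⟩
        x ∙ (y ⁻¹ ∙ (x ∙ x ⁻¹))  ≈⟨ ∙-congˡ (∙-congˡ (inverseʳ x)) ⟩
        x ∙ (y ⁻¹ ∙ ε)           ≈⟨ ∙-congˡ (identityʳ (y ⁻¹)) ⟩
        x ∙ y ⁻¹                 ≈⟨ ∙-congʳ (⁻¹-involutive x) ⟨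
        (x ⁻¹) ⁻¹ ∙ y ⁻¹         ∎) (conj∈ x (~-sym d))

    quotientGroup : Group g s
    quotientGroup = record
      { Carrier = Carrier
      ; _≈_ = _~_
      ; _∙_ = _∙_
      ; ε = ε
      ; _⁻¹ = _⁻¹
      ; isGroup = record
        { isMonoid = record
          { isSemigroup = record
            { isMagma = record
              { isEquivalence = record { refl = ≈⇒~ ≈-refl ; sym = ~-sym ; trans = ~-trans }
              ; ∙-cong = ~-∙
              }
            ; assoc = λ x y z → ≈⇒~ (assoc x y z)
            }
          ; identity = (λ x → ≈⇒~ (identityˡ x)) , (λ x → ≈⇒~ (identityʳ x))
          }
        ; inverse = (λ x → ≈⇒~ (inverseˡ x)) , (λ x → ≈⇒~ (inverseʳ x))
        ; ⁻¹-cong = ~-⁻¹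
        }
      }

module _ {g ℓ b u : Level} (G : NonarchimedeanGroup g ℓ b u) where

  open NonarchimedeanGroup G
  open NormalSubgroup

  -- The quotient topology: a basic open subgroup of G/M is the image of a basic open subgroup of G.

  quotientTopologicalGroup : {s : Level} → NormalSubgroup group s → NonarchimedeanGroup g s b (g ⊔ u ⊔ s)
  quotientTopologicalGroup M = record
    { group = quotientGroup group M
    ; Basis = Basis
    ; U = λ i x → Σ[ y ∈ Carrier ] U i y × y Q.≈ x
    ; U-resp = λ { i e (y , y∈ , d) → y , y∈ , Q.trans {y} d e }
    ; U-ε = λ i → ε , U-ε i , Q.refl {ε}
    ; U-∙ = λ { i (y , y∈ , d) (z , z∈ , e) → y ∙ z , U-∙ i y∈ z∈ , Q.∙-cong {y} {_} {z} d e }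
    ; U-⁻¹ = λ { i (y , y∈ , d) → y ⁻¹ , U-⁻¹ i y∈ , Q.⁻¹-cong {y} d }
    ; U-∩ = λ i j → proj₁ (U-∩ i j) , λ { (y , y∈ , d) →
        (y , proj₁ (proj₂ (U-∩ i j) y∈) , d) , (y , proj₂ (proj₂ (U-∩ i j) y∈) , d) }
    ; U-conj = λ i x → proj₁ (U-conj i x) , λ { {z} (y , y∈ , d) →
        x ∙ y ∙ x ⁻¹ , proj₂ (U-conj i x) y∈ ,
        Q.∙-congʳ {x ⁻¹} {x ∙ y} {x ∙ z} (Q.∙-congˡ {x} {y} {z} d) }
    ; inhabited = inhabited
    }
    where module Q = Group (quotientGroup group M)

  IsOpen : {s : Level} → NormalSubgroup group s → Set (g ⊔ b ⊔ u ⊔ s)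
  IsOpen N = Σ[ i ∈ Basis ] (∀ {x} → U i x → N ∋ₙ x)

  HasIndex : {s : Level} → NormalSubgroup group s → ℕ → Set (g ⊔ s)
  HasIndex N n = Bijection (≡.setoid (Fin n)) (Group.setoid (quotientGroup group N))

  module _ (p : ℕ) where

    -- The kernel of G → G(p): the intersection of all open normal subgroups of p-power index

    pro-p-kernel : NormalSubgroup group (g ⊔ ℓ ⊔ b ⊔ lsuc u)
    pro-p-kernel = record
      { _∋ₙ_ = λ x → (N : NormalSubgroup group u) → IsOpen N → (Σ[ r ∈ ℕ ] HasIndex N (p ℕ.^ r)) → N ∋ₙ x
      ; resp = λ e d N o i → resp N e (d N o i)
      ; ε∈ = λ N o i → ε∈ N
      ; ∙∈ = λ d e N o i → ∙∈ N (d N o i) (e N o i)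
      ; ⁻¹∈ = λ d N o i → ⁻¹∈ N (d N o i)
      ; conj∈ = λ x d N o i → conj∈ N x (d N o i)
      }

    maximalProPQuotient : NonarchimedeanGroup g (g ⊔ ℓ ⊔ b ⊔ lsuc u) b (g ⊔ ℓ ⊔ b ⊔ lsuc u)
    maximalProPQuotient = quotientTopologicalGroup pro-p-kernel

-- Continuous cohomology with trivial discrete coefficients, by homogeneous cochains.

module _ {g ℓ b u : Level} (G : NonarchimedeanGroup g ℓ b u) (k : CommutativeRing 0ℓ 0ℓ) where

  open NonarchimedeanGroup G using (Carrier; _∙_; _⁻¹; Basis; U; U-∩; inhabited)

  private
    module k = CommutativeRing k
    open k using (_≈_; _+_; _*_; _-_; -_; 0#; 1#)
    open RingProperties k.ring using (-0#≈0#; -‿+-comm; -‿distribˡ-*; -‿distribʳ-*; -‿involutive)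
    open ≈-Reasoning k.setoid

    a : Level
    a = g ⊔ b ⊔ u

    Fun : ℕ → Set g
    Fun n = Vec Carrier n → k.Carrier

  -- ys lies in the basic open neighbourhood (x₁Uᵢ) × … × (xₙUᵢ) of xs.

  Near : Basis → ∀ {n} → Vec Carrier n → Vec Carrier n → Set (g ⊔ u)
  Near i = Pointwise (λ x y → U i (x ⁻¹ ∙ y))

  Continuous : ∀ {n} → Fun n → Set a
  Continuous f = ∀ xs → Σ[ i ∈ Basis ] (∀ ys → Near i xs ys → f ys ≈ f xs)

  Invariant : ∀ {n} → Fun n → Set g
  Invariant f = ∀ σ xs → f (Vec.map (σ ∙_) xs) ≈ f xs

  functions : ℕ → LeftModule k.ring g g
  functions n = leftModule (λ (f h : Fun n) → ∀ xs → f xs ≈ h xs)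
    (λ f h xs → f xs + h xs) (λ _ → 0#) (λ f xs → - f xs) (λ c f xs → c * f xs)
    (record
      { isEquivalence = record
        { refl = λ _ → k.refl ; sym = λ d xs → k.sym (d xs) ; trans = λ d e xs → k.trans (d xs) (e xs) }
      ; +-cong = λ d e xs → k.+-cong (d xs) (e xs)
      ; neg-cong = λ d xs → k.-‿cong (d xs)
      ; +-assoc = λ f h l xs → k.+-assoc (f xs) (h xs) (l xs)
      ; +-comm = λ f h xs → k.+-comm (f xs) (h xs)
      ; +-identityˡ = λ f xs → k.+-identityˡ (f xs)
      ; +-inverseˡ = λ f xs → k.-‿inverseˡ (f xs)
      ; *-cong = λ c d xs → k.*-cong c (d xs)
      ; *-distribʳ = λ f c d xs → k.distribʳ (f xs) c d
      ; *-distribˡ = λ c f h xs → k.distribˡ c (f xs) (h xs)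
      ; *-identityˡ = λ f xs → k.*-identityˡ (f xs)
      ; *-assoc = λ c d f xs → k.*-assoc c d (f xs)
      })

  -- Cⁿ consists of functions on Gⁿ⁺¹.

  IsCochain : ∀ n → Subspace (functions (suc n)) a
  IsCochain n = record
    { _∋_ = λ f → Continuous f × Invariant f
    ; resp = λ { {f} {h} d (cont , inv) →
        (λ xs → proj₁ (cont xs) , λ ys near →
          k.trans (k.sym (d ys)) (k.trans (proj₂ (cont xs) ys near) (d xs))) ,
        (λ σ xs → k.trans (k.sym (d _)) (k.trans (inv σ xs) (d xs))) }
    ; 0∈ = (λ _ → inhabited , λ _ _ → k.refl) , (λ _ _ → k.refl)
    ; +∈ = λ { {f} {h} (cont , inv) (cont′ , inv′) →
        (λ xs → let i , near-i = cont xs ; j , near-j = cont′ xs ; l , ∩ = U-∩ i j in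
          l , λ ys near → k.+-cong (near-i ys (Pw.map (λ e → proj₁ (∩ e)) near))
                                   (near-j ys (Pw.map (λ e → proj₂ (∩ e)) near))) ,
        (λ σ xs → k.+-cong (inv σ xs) (inv′ σ xs)) }
    ; *∈ = λ { c (cont , inv) →
        (λ xs → proj₁ (cont xs) , λ ys near → k.*-congˡ (proj₂ (cont xs) ys near)) ,
        (λ σ xs → k.*-congˡ (inv σ xs)) }
    }

  cochains : ℕ → LeftModule k.ring a g
  cochains n = submodule (functions (suc n)) (IsCochain n)

  alternatingSum : ∀ {n} → (Fin n → k.Carrier) → k.Carrier
  alternatingSum {zero}  t = 0#
  alternatingSum {suc n} t = t zero - alternatingSum (t ∘ suc)

  -- (df)(x₀,…,xₙ) = Σᵢ (-1)ⁱ f(x₀,…,x̂ᵢ,…,xₙ)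

  d : ∀ {n} → Fun n → Fun (suc n)
  d f xs = alternatingSum (λ i → f (removeAt xs i))

  private
    alt-cong : ∀ {n} {t s : Fin n → k.Carrier} → (∀ i → t i ≈ s i) → alternatingSum t ≈ alternatingSum s
    alt-cong {zero}  e = k.refl
    alt-cong {suc n} e = k.+-cong (e zero) (k.-‿cong (alt-cong (e ∘ suc)))

    alt-0 : ∀ n → alternatingSum {n} (λ _ → 0#) ≈ 0#
    alt-0 zero    = k.refl
    alt-0 (suc n) = k.trans (k.+-identityˡ _) (k.trans (k.-‿cong (alt-0 n)) -0#≈0#)

    interchange : ∀ w x y z → (w + x) + (y + z) ≈ (w + y) + (x + z)
    interchange w x y z = begin
      (w + x) + (y + z)  ≈⟨ k.+-assoc w x (y + z) ⟩
      w + (x + (y + z))  ≈⟨ k.+-congˡ (k.+-assoc x y z) ⟨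
      w + ((x + y) + z)  ≈⟨ k.+-congˡ (k.+-congʳ (k.+-comm x y)) ⟩
      w + ((y + x) + z)  ≈⟨ k.+-congˡ (k.+-assoc y x z) ⟩
      w + (y + (x + z))  ≈⟨ k.+-assoc w y (x + z) ⟨
      (w + y) + (x + z)  ∎

    alt-+ : ∀ {n} (t s : Fin n → k.Carrier) →
            alternatingSum (λ i → t i + s i) ≈ alternatingSum t + alternatingSum s
    alt-+ {zero}  t s = k.sym (k.+-identityˡ 0#)
    alt-+ {suc n} t s = begin
      (t zero + s zero) - alternatingSum (λ i → t (suc i) + s (suc i))
        ≈⟨ k.+-congˡ (k.-‿cong (alt-+ (t ∘ suc) (s ∘ suc))) ⟩
      (t zero + s zero) - (alternatingSum (t ∘ suc) + alternatingSum (s ∘ suc))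
        ≈⟨ k.+-congˡ (-‿+-comm _ _) ⟨
      (t zero + s zero) + (- alternatingSum (t ∘ suc) + - alternatingSum (s ∘ suc))
        ≈⟨ interchange _ _ _ _ ⟩
      (t zero - alternatingSum (t ∘ suc)) + (s zero - alternatingSum (s ∘ suc)) ∎

    alt-* : ∀ {n} c (t : Fin n → k.Carrier) → alternatingSum (λ i → c * t i) ≈ c * alternatingSum t
    alt-* {zero}  c t = k.sym (k.zeroʳ c)
    alt-* {suc n} c t = begin
      c * t zero - alternatingSum (λ i → c * t (suc i))  ≈⟨ k.+-congˡ (k.-‿cong (alt-* c (t ∘ suc))) ⟩
      c * t zero - c * alternatingSum (t ∘ suc)          ≈⟨ k.+-congˡ (-‿distribʳ-* c _) ⟩
      c * t zero + c * (- alternatingSum (t ∘ suc))      ≈⟨ k.distribˡ c _ _ ⟨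
      c * (t zero - alternatingSum (t ∘ suc))            ∎

    d-0 : ∀ {n} xs → d {n} (λ _ → 0#) xs ≈ 0#
    d-0 {n} _ = alt-0 (suc n)

    d-+ : ∀ {n} (f h : Fun n) xs → d (λ ys → f ys + h ys) xs ≈ d f xs + d h xs
    d-+ f h xs = alt-+ (λ i → f (removeAt xs i)) (λ i → h (removeAt xs i))

    d-* : ∀ {n} c (f : Fun n) xs → d (λ ys → c * f ys) xs ≈ c * d f xs
    d-* c f xs = alt-* c (λ i → f (removeAt xs i))

    d-cong : ∀ {n} {f h : Fun n} → (∀ ys → f ys ≈ h ys) → ∀ xs → d f xs ≈ d h xs
    d-cong e xs = alt-cong (λ i → e (removeAt xs i))

  IsCocycle : ∀ n → Subspace (cochains n) g
  IsCocycle n = record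
    { _∋_ = λ f → ∀ xs → d (proj₁ f) xs ≈ 0#
    ; resp = λ e z xs → k.trans (d-cong (λ ys → k.sym (e ys)) xs) (z xs)
    ; 0∈ = d-0
    ; +∈ = λ {f} {h} z z′ xs → k.trans (d-+ (proj₁ f) (proj₁ h) xs)
             (k.trans (k.+-cong (z xs) (z′ xs)) (k.+-identityˡ 0#))
    ; *∈ = λ c {f} z xs → k.trans (d-* c (proj₁ f) xs) (k.trans (k.*-congˡ (z xs)) (k.zeroʳ c))
    }

  cocycles : ℕ → LeftModule k.ring a g
  cocycles n = submodule (cochains n) (IsCocycle n)

  -- C⁻¹ = 0, so a coboundary in degree 0 vanishes.

  data Coboundary : ∀ n → Pred (Fun (suc n)) a where
    vanishing : ∀ {f} → (∀ xs → f xs ≈ 0#) → Coboundary 0 f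
    boundary  : ∀ {n} {f : Fun (suc (suc n))} (h : LeftModule.Carrierᴹ (cochains n)) →
           (∀ xs → f xs ≈ d (proj₁ h) xs) → Coboundary (suc n) f

  private
    Coboundary-resp : ∀ {n} {f h : Fun (suc n)} → (∀ xs → f xs ≈ h xs) → Coboundary n f → Coboundary n h
    Coboundary-resp e (vanishing z) = vanishing (λ xs → k.trans (k.sym (e xs)) (z xs))
    Coboundary-resp e (boundary c z)  = boundary c (λ xs → k.trans (k.sym (e xs)) (z xs))

    Coboundary-0 : ∀ n → Coboundary n (λ _ → 0#)
    Coboundary-0 zero    = vanishing (λ _ → k.refl)
    Coboundary-0 (suc n) = boundary (LeftModule.0ᴹ (cochains n)) (λ xs → k.sym (d-0 xs))

    Coboundary-+ : ∀ {n} {f h : Fun (suc n)} → Coboundary n f → Coboundary n h → Coboundary n (λ xs → f xs + h xs)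
    Coboundary-+ (vanishing z) (vanishing z′) = vanishing (λ xs → k.trans (k.+-cong (z xs) (z′ xs)) (k.+-identityˡ 0#))
    Coboundary-+ (boundary {n} c z) (boundary c′ z′) = boundary (LeftModule._+ᴹ_ (cochains n) c c′)
      (λ xs → k.trans (k.+-cong (z xs) (z′ xs)) (k.sym (d-+ (proj₁ c) (proj₁ c′) xs)))

    Coboundary-* : ∀ {n} c {f : Fun (suc n)} → Coboundary n f → Coboundary n (λ xs → c * f xs)
    Coboundary-* c (vanishing z) = vanishing (λ xs → k.trans (k.*-congˡ (z xs)) (k.zeroʳ c))
    Coboundary-* c (boundary {n} c′ z) = boundary (LeftModule._*ₗ_ (cochains n) c c′)
      (λ xs → k.trans (k.*-congˡ (z xs)) (k.sym (d-* c (proj₁ c′) xs)))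

  IsCoboundary : ∀ n → Subspace (cocycles n) a
  IsCoboundary n = record
    { _∋_ = λ f → Coboundary n (proj₁ (proj₁ f))
    ; resp = Coboundary-resp
    ; 0∈ = Coboundary-0 n
    ; +∈ = Coboundary-+
    ; *∈ = λ c → Coboundary-* c
    }

  H : ℕ → LeftModule k.ring a a
  H n = quotient (cocycles n) (IsCoboundary n)

  -- For m + n = l, the front face (x₀,…,xₘ) and the back face (xₘ,…,xₗ) of (x₀,…,xₗ)

  front : ∀ {m n l} → m ∔ n ≐ l → Vec Carrier (suc l) → Vec Carrier (suc m)
  front zero    (x ∷ xs) = x ∷ []
  front (suc e) (x ∷ xs) = x ∷ front e xs

  back : ∀ {m n l} → m ∔ n ≐ l → Vec Carrier (suc l) → Vec Carrier (suc n)
  back zero    xs       = xs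
  back (suc e) (x ∷ xs) = back e xs

  cup : ∀ {m n l} → m ∔ n ≐ l → Fun (suc m) → Fun (suc n) → Fun (suc l)
  cup e f h xs = f (front e xs) * h (back e xs)

  private
    front-map : ∀ {m n l} (e : m ∔ n ≐ l) (φ : Carrier → Carrier) xs →
                front e (Vec.map φ xs) ≡ Vec.map φ (front e xs)
    front-map zero    φ (x ∷ xs) = refl
    front-map (suc e) φ (x ∷ xs) = cong (φ x ∷_) (front-map e φ xs)

    back-map : ∀ {m n l} (e : m ∔ n ≐ l) (φ : Carrier → Carrier) xs →
               back e (Vec.map φ xs) ≡ Vec.map φ (back e xs)
    back-map zero    φ xs       = refl
    back-map (suc e) φ (x ∷ xs) = back-map e φ xs

    front-near : ∀ {i m n l} (e : m ∔ n ≐ l) {xs ys} → Near i xs ys → Near i (front e xs) (front e ys)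
    front-near zero    (x ∷ xs) = x ∷ []
    front-near (suc e) (x ∷ xs) = x ∷ front-near e xs

    back-near : ∀ {i m n l} (e : m ∔ n ≐ l) {xs ys} → Near i xs ys → Near i (back e xs) (back e ys)
    back-near zero    xs       = xs
    back-near (suc e) (x ∷ xs) = back-near e xs

    ∔-irrelevant : ∀ {m n l} (e f : m ∔ n ≐ l) → e ≡ f
    ∔-irrelevant zero    zero    = refl
    ∔-irrelevant (suc e) (suc f) = cong suc (∔-irrelevant e f)

    front-front : ∀ {i j l ij jl ijl} (e : i ∔ j ≐ ij) (f : ij ∔ l ≐ ijl) (h : i ∔ jl ≐ ijl) xs →
                  front e (front f xs) ≡ front h xs
    front-front zero    zero    zero    (x ∷ xs) = refl
    front-front zero    (suc f) zero    (x ∷ xs) = refl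
    front-front (suc e) (suc f) (suc h) (x ∷ xs) = cong (x ∷_) (front-front e f h xs)

    back-front : ∀ {i j l ij jl ijl} (e : i ∔ j ≐ ij) (f : ij ∔ l ≐ ijl) (g : j ∔ l ≐ jl) (h : i ∔ jl ≐ ijl)
                 xs → back e (front f xs) ≡ front g (back h xs)
    back-front zero    f       g zero    xs       = cong (λ e → front e xs) (∔-irrelevant f g)
    back-front (suc e) (suc f) g (suc h) (x ∷ xs) = back-front e f g h xs

    back-back : ∀ {i j l ij jl ijl} (e : i ∔ j ≐ ij) (f : ij ∔ l ≐ ijl) (g : j ∔ l ≐ jl) (h : i ∔ jl ≐ ijl)
                xs → back f xs ≡ back g (back h xs)
    back-back zero    f       g zero    xs       = cong (λ e → back e xs) (∔-irrelevant f g)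
    back-back (suc e) (suc f) g (suc h) (x ∷ xs) = back-back e f g h xs

    front-all : ∀ {n} (e : n ∔ 0 ≐ n) xs → front e xs ≡ xs
    front-all zero    (x ∷ []) = refl
    front-all (suc e) (x ∷ xs) = cong (x ∷_) (front-all e xs)

    cup-cochain : ∀ {m n l} (e : m ∔ n ≐ l) {f h} → IsCochain m ∋ f → IsCochain n ∋ h →
                  IsCochain l ∋ cup e f h
    cup-cochain e {f} {h} (cont , inv) (cont′ , inv′) =
      (λ xs → let i , near-i = cont (front e xs) ; j , near-j = cont′ (back e xs) ; l , ∩ = U-∩ i j in
        l , λ ys near → k.*-cong (near-i _ (front-near e (Pw.map (λ v → proj₁ (∩ v)) near)))
                                 (near-j _ (back-near e (Pw.map (λ v → proj₂ (∩ v)) near)))) ,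
      (λ σ xs → k.*-cong
        (k.trans (k.reflexive (cong f (front-map e (σ ∙_) xs))) (inv σ (front e xs)))
        (k.trans (k.reflexive (cong h (back-map e (σ ∙_) xs))) (inv′ σ (back e xs))))

    sign : ℕ → k.Carrier
    sign zero    = 1#
    sign (suc m) = - sign m

    sign² : ∀ m → sign m * sign m ≈ 1#
    sign² zero    = k.*-identityˡ 1#
    sign² (suc m) = begin
      - sign m * - sign m      ≈⟨ -‿distribˡ-* (sign m) (- sign m) ⟨
      - (sign m * - sign m)    ≈⟨ k.-‿cong (-‿distribʳ-* (sign m) (sign m)) ⟨
      - (- (sign m * sign m))  ≈⟨ -‿involutive _ ⟩
      sign m * sign m          ≈⟨ sign² m ⟩
      1#                       ∎

    leibniz : ∀ {m n l} (e : m ∔ n ≐ l) (e₂ : m ∔ suc n ≐ suc l) f h xs →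
              d (cup e f h) xs ≈ cup (suc e) (d f) h xs + sign m * cup e₂ f (d h) xs
    leibniz zero zero f h (x ∷ y ∷ xs) = begin
      f₁ * h₁ - alternatingSum (λ i → f₀ * h (x ∷ removeAt (y ∷ xs) i))
        ≈⟨ k.+-congˡ (k.-‿cong (d-* f₀ (h ∘ (x ∷_)) (y ∷ xs))) ⟩
      f₁ * h₁ - f₀ * D
        ≈⟨ k.+-congˡ (k.trans (k.+-congʳ (k.-‿inverseˡ (f₀ * h₁))) (k.+-identityˡ _)) ⟨
      f₁ * h₁ + ((- (f₀ * h₁) + f₀ * h₁) - f₀ * D)
        ≈⟨ k.+-congˡ (k.+-assoc _ _ _) ⟩
      f₁ * h₁ + (- (f₀ * h₁) + (f₀ * h₁ - f₀ * D))
        ≈⟨ k.+-assoc _ _ _ ⟨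
      (f₁ * h₁ - f₀ * h₁) + (f₀ * h₁ - f₀ * D)
        ≈⟨ k.+-cong (k.+-congˡ (-‿distribˡ-* f₀ h₁)) (k.+-congˡ (-‿distribʳ-* f₀ D)) ⟩
      (f₁ * h₁ + - f₀ * h₁) + (f₀ * h₁ + f₀ * - D)
        ≈⟨ k.+-cong (k.distribʳ h₁ f₁ (- f₀)) (k.distribˡ f₀ h₁ (- D)) ⟨
      (f₁ - f₀) * h₁ + f₀ * (h₁ - D)
        ≈⟨ k.+-cong (k.*-congʳ (k.+-congˡ (k.-‿cong (k.trans (k.+-congˡ -0#≈0#) (k.+-identityʳ f₀)))))
                    (k.*-identityˡ _) ⟨
      (f₁ - (f₀ - 0#)) * h₁ + 1# * (f₀ * (h₁ - D)) ∎
      where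
      f₀ = f (x ∷ [])
      f₁ = f (y ∷ [])
      h₁ = h (y ∷ xs)
      D  = d (h ∘ (x ∷_)) (y ∷ xs)
    leibniz {suc m} (suc e) (suc e₂) f h (x ∷ y ∷ xs) = begin
      F * h′ - d (cup e (f ∘ (x ∷_)) h) (y ∷ xs)
        ≈⟨ k.+-congˡ (k.-‿cong (leibniz e e₂ (f ∘ (x ∷_)) h (y ∷ xs))) ⟩
      F * h′ - (D * h′ + sign m * E)
        ≈⟨ k.+-congˡ (-‿+-comm _ _) ⟨
      F * h′ + (- (D * h′) + - (sign m * E))
        ≈⟨ k.+-assoc _ _ _ ⟨
      (F * h′ - D * h′) + - (sign m * E)
        ≈⟨ k.+-cong (k.+-congˡ (-‿distribˡ-* D h′)) (-‿distribˡ-* (sign m) E) ⟩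
      (F * h′ + - D * h′) + - sign m * E
        ≈⟨ k.+-congʳ (k.distribʳ h′ F (- D)) ⟨
      (F - D) * h′ + - sign m * E ∎
      where
      F  = f (y ∷ front e xs)
      h′ = h (back e xs)
      D  = d (f ∘ (x ∷_)) (y ∷ front e xs)
      E  = cup e₂ (f ∘ (x ∷_)) (d h) (y ∷ xs)

    cup-vanishʳ : ∀ {m n l} (e : m ∔ n ≐ l) f {h} → (∀ xs → h xs ≈ 0#) → ∀ xs → cup e f h xs ≈ 0#
    cup-vanishʳ e f z xs = k.trans (k.*-congˡ (z _)) (k.zeroʳ _)

    cup-vanishˡ : ∀ {m n l} (e : m ∔ n ≐ l) {f} h → (∀ xs → f xs ≈ 0#) → ∀ xs → cup e f h xs ≈ 0#
    cup-vanishˡ e h z xs = k.trans (k.*-congʳ (z _)) (k.zeroˡ _)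

    leibnizˡ : ∀ {m n l} (e : m ∔ n ≐ l) f h → (∀ xs → d h xs ≈ 0#) →
               ∀ xs → d (cup e f h) xs ≈ cup (suc e) (d f) h xs
    leibnizˡ {m} e f h z xs = begin
      d (cup e f h) xs                                              ≈⟨ leibniz e (∔-suc e) f h xs ⟩
      cup (suc e) (d f) h xs + sign m * cup (∔-suc e) f (d h) xs   ≈⟨ k.+-congˡ (k.*-congˡ (cup-vanishʳ (∔-suc e) f z xs)) ⟩
      cup (suc e) (d f) h xs + sign m * 0#                          ≈⟨ k.+-congˡ (k.zeroʳ _) ⟩
      cup (suc e) (d f) h xs + 0#                                   ≈⟨ k.+-identityʳ _ ⟩
      cup (suc e) (d f) h xs                                        ∎

    leibnizʳ : ∀ {m n l} (e : m ∔ n ≐ l) (e₂ : m ∔ suc n ≐ suc l) f h → (∀ xs → d f xs ≈ 0#) →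
               ∀ xs → d (cup e f h) xs ≈ sign m * cup e₂ f (d h) xs
    leibnizʳ {m} e e₂ f h z xs = begin
      d (cup e f h) xs                                     ≈⟨ leibniz e e₂ f h xs ⟩
      cup (suc e) (d f) h xs + sign m * cup e₂ f (d h) xs  ≈⟨ k.+-congʳ (cup-vanishˡ (suc e) h z xs) ⟩
      0# + sign m * cup e₂ f (d h) xs                      ≈⟨ k.+-identityˡ _ ⟩
      sign m * cup e₂ f (d h) xs                           ∎

    cup-cocycle : ∀ {m n l} (e : m ∔ n ≐ l) f h → (∀ xs → d f xs ≈ 0#) → (∀ xs → d h xs ≈ 0#) →
                  ∀ xs → d (cup e f h) xs ≈ 0#
    cup-cocycle e f h z z′ xs = k.trans (leibnizˡ e f h z′ xs) (cup-vanishˡ (suc e) h z xs)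

    ∔-suc⁻¹ : ∀ {m n l} → m ∔ suc n ≐ l → Σ[ l′ ∈ ℕ ] l ≡ suc l′ × m ∔ n ≐ l′
    ∔-suc⁻¹ zero    = _ , refl , zero
    ∔-suc⁻¹ (suc e) with ∔-suc⁻¹ e
    ... | _ , refl , e′ = _ , refl , suc e′

    ⌊_⌋ : ∀ {n} → LeftModule.Carrierᴹ (cocycles n) → Fun (suc n)
    ⌊ (f , _) , _ ⌋ = f

    Coboundary-cup : ∀ {m n l} (e : m ∔ n ≐ l) {f} (y : LeftModule.Carrierᴹ (cocycles n)) →
                     Coboundary m f → Coboundary l (cup e f ⌊ y ⌋)
    Coboundary-cup {l = l} e y (vanishing z) =
      Coboundary-resp (λ xs → k.sym (cup-vanishˡ e ⌊ y ⌋ z xs)) (Coboundary-0 l)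
    Coboundary-cup (suc e) ((h , h∈) , z′) (boundary (c , c∈) z) =
      boundary (cup e c h , cup-cochain e c∈ h∈)
        (λ xs → k.trans (k.*-congʳ (z (front (suc e) xs))) (k.sym (leibnizˡ e c h z′ xs)))

    cup-Coboundary : ∀ {m n l} (e : m ∔ n ≐ l) (y : LeftModule.Carrierᴹ (cocycles m)) {f} →
                     Coboundary n f → Coboundary l (cup e ⌊ y ⌋ f)
    cup-Coboundary {l = l} e y (vanishing z) =
      Coboundary-resp (λ xs → k.sym (cup-vanishʳ e ⌊ y ⌋ z xs)) (Coboundary-0 l)
    cup-Coboundary {m} e ((h , h∈) , z′) (boundary (c , c∈) z) with ∔-suc⁻¹ e
    ... | l , refl , e′ = boundary (LeftModule._*ₗ_ (cochains l) (sign m) (cup e′ h c , cup-cochain e′ h∈ c∈))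
        (λ xs → begin
          h (front e xs) * _                      ≈⟨ k.*-congˡ (z (back e xs)) ⟩
          cup e h (d c) xs                        ≈⟨ k.*-identityˡ _ ⟨
          1# * cup e h (d c) xs                   ≈⟨ k.*-congʳ (sign² m) ⟨
          (sign m * sign m) * cup e h (d c) xs    ≈⟨ k.*-assoc _ _ _ ⟩
          sign m * (sign m * cup e h (d c) xs)    ≈⟨ k.*-congˡ (leibnizʳ e′ e h c z′ xs) ⟨
          sign m * d (cup e′ h c) xs              ≈⟨ d-* (sign m) (cup e′ h c) xs ⟨
          d (λ ys → sign m * cup e′ h c ys) xs    ∎)

    product : ∀ {m n l} → m ∔ n ≐ l → LeftModule.Carrierᴹ (cocycles m) → LeftModule.Carrierᴹ (cocycles n) →
              LeftModule.Carrierᴹ (cocycles l)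
    product e ((f , f∈) , z) ((h , h∈) , z′) = (cup e f h , cup-cochain e f∈ h∈) , cup-cocycle e f h z z′

    unit : LeftModule.Carrierᴹ (cocycles 0)
    unit = ((λ _ → 1#) , (λ _ → inhabited , λ _ _ → k.refl) , λ _ _ → k.refl) , z
      where
      z : ∀ (xs : Vec Carrier 2) → d {1} (λ _ → 1#) xs ≈ 0#
      z (x ∷ y ∷ []) = k.trans (k.+-congˡ (k.-‿cong (k.trans (k.+-congˡ -0#≈0#) (k.+-identityʳ 1#)))) (k.-‿inverseʳ 1#)

    infix 4 _∼_

    _∼_ : ∀ {n} → Rel (LeftModule.Carrierᴹ (cocycles n)) a
    _∼_ {n} = LeftModule._≈ᴹ_ (H n)

    pointwise : ∀ {n} (x y : LeftModule.Carrierᴹ (cocycles n)) → (∀ xs → ⌊ x ⌋ xs ≈ ⌊ y ⌋ xs) → x ∼ y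
    pointwise {n} x y e = quotient-≈ (cocycles n) (IsCoboundary n) {x} {y} e

    product-cong : ∀ {m n l} (e : m ∔ n ≐ l) {x y u v} → x ∼ y → u ∼ v → product e x u ∼ product e y v
    product-cong {m} {n} e {x} {y} {u} {v} p q = Coboundary-resp
      (λ xs → let f = ⌊ x ⌋ (front e xs) ; f′ = ⌊ y ⌋ (front e xs)
                  h = ⌊ u ⌋ (back e xs) ; h′ = ⌊ v ⌋ (back e xs) in begin
        (f - f′) * h + f′ * (h - h′)                     ≈⟨ k.+-cong (k.distribʳ h f (- f′)) (k.distribˡ f′ h (- h′)) ⟩
        (f * h + - f′ * h) + (f′ * h + f′ * - h′)        ≈⟨ k.+-assoc _ _ _ ⟩
        f * h + (- f′ * h + (f′ * h + f′ * - h′))        ≈⟨ k.+-congˡ (k.+-assoc _ _ _) ⟨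
        f * h + ((- f′ * h + f′ * h) + f′ * - h′)        ≈⟨ k.+-congˡ (k.+-congʳ (k.distribʳ h (- f′) f′)) ⟨
        f * h + ((- f′ + f′) * h + f′ * - h′)            ≈⟨ k.+-congˡ (k.+-congʳ (k.trans (k.*-congʳ (k.-‿inverseˡ f′)) (k.zeroˡ h))) ⟩
        f * h + (0# + f′ * - h′)                         ≈⟨ k.+-congˡ (k.+-identityˡ _) ⟩
        f * h + f′ * - h′                                ≈⟨ k.+-congˡ (-‿distribʳ-* f′ h′) ⟨
        f * h - f′ * h′                                  ∎)
      (Coboundary-+ (Coboundary-cup e u p) (cup-Coboundary e y q))

  H• : GradedAlgebra k a
  H• = record
    { component = H
    ; mul = product
    ; 1# = unit
    ; mul-cong = λ e {x} {y} {u} {v} → product-cong e {x} {y} {u} {v}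
    ; distribˡ = λ {m} {n} {l} e x y z → pointwise (product e x (addᴴ n y z)) (addᴴ l (product e x y) (product e x z))
        (λ _ → k.distribˡ _ _ _)
    ; distribʳ = λ {m} {n} {l} e x y z → pointwise (product e (addᴴ m y z) x) (addᴴ l (product e y x) (product e z x))
        (λ _ → k.distribʳ _ _ _)
    ; *ₗ-mul = λ {m} {n} {l} e c x y → pointwise (product e (scaleᴴ m c x) y) (scaleᴴ l c (product e x y))
        (λ _ → k.*-assoc _ _ _)
    ; mul-*ₗ = λ {m} {n} {l} e c x y → pointwise (product e x (scaleᴴ n c y)) (scaleᴴ l c (product e x y))
        (λ _ → k.trans (k.sym (k.*-assoc _ _ _)) (k.trans (k.*-congʳ (k.*-comm _ _)) (k.*-assoc _ _ _)))
    ; identityˡ = λ { zero x → pointwise (product zero unit x) x (λ _ → k.*-identityˡ _) }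
    ; identityʳ = λ e x → pointwise (product e x unit) x
        (λ xs → k.trans (k.*-identityʳ _) (k.reflexive (cong ⌊ x ⌋ (front-all e xs))))
    ; assoc = λ e f g h x y z → pointwise (product f (product e x y) z) (product h x (product g y z))
        (λ xs → k.trans (k.*-assoc _ _ _)
          (k.*-cong (k.reflexive (cong ⌊ x ⌋ (front-front e f h xs)))
          (k.*-cong (k.reflexive (cong ⌊ y ⌋ (back-front e f g h xs)))
                    (k.reflexive (cong ⌊ z ⌋ (back-back e f g h xs))))))
    }
    where
    addᴴ : ∀ n → LeftModule.Carrierᴹ (H n) → LeftModule.Carrierᴹ (H n) → LeftModule.Carrierᴹ (H n)
    addᴴ n = LeftModule._+ᴹ_ (H n)
    scaleᴴ : ∀ n → k.Carrier → LeftModule.Carrierᴹ (H n) → LeftModule.Carrierᴹ (H n)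
    scaleᴴ n = LeftModule._*ₗ_ (H n)

record Field (c ℓ : Level) : Set (lsuc (c ⊔ ℓ)) where
  field
    commutativeRing : CommutativeRing c ℓ

  open CommutativeRing commutativeRing public

  field
    0≉1        : ¬ 0# ≈ 1#
    invertible : ∀ x → ¬ x ≈ 0# → Σ[ y ∈ Carrier ] x * y ≈ 1#

-- Polynomials as lists of coefficients, constant term first

module Polynomial {c ℓ : Level} (R : CommutativeRing c ℓ) where

  open CommutativeRing R

  Poly : Set c
  Poly = List Carrier

  coefficient : Poly → ℕ → Carrier
  coefficient []      _       = 0#
  coefficient (x ∷ f) zero    = x
  coefficient (x ∷ f) (suc n) = coefficient f n

  infix  4 _≈ₚ_
  infixl 6 _+ₚ_
  infixl 7 _*ₚ_

  _≈ₚ_ : Rel Poly ℓ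
  f ≈ₚ g = ∀ n → coefficient f n ≈ coefficient g n

  _+ₚ_ : Poly → Poly → Poly
  []      +ₚ g       = g
  (x ∷ f) +ₚ []      = x ∷ f
  (x ∷ f) +ₚ (y ∷ g) = x + y ∷ f +ₚ g

  _*ₚ_ : Poly → Poly → Poly
  []      *ₚ g = []
  (x ∷ f) *ₚ g = map (x *_) g +ₚ (0# ∷ f *ₚ g)

  1ₚ : Poly
  1ₚ = 1# ∷ []

  -- (x + X f)′ = f + X f′

  derivative : Poly → Poly
  derivative []      = []
  derivative (x ∷ f) = f +ₚ (0# ∷ derivative f)

  evaluate : Poly → Carrier → Carrier
  evaluate []      a = 0#
  evaluate (x ∷ f) a = x + a * evaluate f a

  Nonconstant : Poly → Set ℓ
  Nonconstant f = Σ[ n ∈ ℕ ] ¬ coefficient f (suc n) ≈ 0#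

  -- f and f′ generate the unit ideal.

  Separable : Poly → Set (c ⊔ ℓ)
  Separable f = Σ[ u ∈ Poly ] Σ[ v ∈ Poly ] u *ₚ f +ₚ v *ₚ derivative f ≈ₚ 1ₚ

module _ {c ℓ : Level} (K : Field c ℓ) where

  private
    module K = Field K
    module K[X] = Polynomial K.commutativeRing

  record SeparableClosure : Set (lsuc (c ⊔ ℓ)) where
    field
      closure : Field c ℓ

    open Field closure public
    open Polynomial (Field.commutativeRing closure)

    field
      ι                  : K.Carrier → Carrier
      isRingHomomorphism : RingMorphisms.IsRingHomomorphism K.rawRing rawRing ι
      separable          : ∀ x → Σ[ f ∈ K[X].Poly ] K[X].Separable f × evaluate (map ι f) x ≈ 0#
      separablyClosed    : ∀ f → Separable f → Nonconstant f → Σ[ x ∈ Carrier ] evaluate f x ≈ 0#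

  module _ (Kˢ : SeparableClosure) where

    open SeparableClosure Kˢ

    private
      open module ≈ᶠ = Field closure using () renaming (refl to ≈-refl; sym to ≈-sym; trans to ≈-trans)

    -- K ⊃ μₚ, where μₚ is the group of p-th roots of unity in Kˢ

    ContainsRootsOfUnity : ℕ → Set (c ⊔ ℓ)
    ContainsRootsOfUnity p = ∀ x → x ^ p ≈ 1# → Σ[ y ∈ K.Carrier ] ι y ≈ x
      where open Exp semiring using (_^_)

    record Automorphism : Set (c ⊔ ℓ) where
      constructor automorphism
      field
        _$_   : Carrier → Carrier
        isIso : RingMorphisms.IsRingIsomorphism rawRing rawRing _$_
        fixes : ∀ x → _$_ (ι x) ≈ ι x

      open RingMorphisms.IsRingIsomorphism isIso public

    open Automorphism using (_$_; fixes)

    private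
      identity′ : Automorphism
      identity′ = automorphism id (Identity.isRingIsomorphism rawRing ≈-refl) (λ _ → ≈-refl)

      _∘′_ : Automorphism → Automorphism → Automorphism
      σ ∘′ τ = automorphism (λ x → σ $ (τ $ x))
        (Compose.isRingIsomorphism ≈-trans (Automorphism.isIso τ) (Automorphism.isIso σ))
        (λ x → ≈-trans (Automorphism.⟦⟧-cong σ (fixes τ x)) (fixes σ x))

      module _ (σ : Automorphism) where
        open Automorphism σ using (injective; surjective; ⟦⟧-cong; +-homo; *-homo; 0#-homo; 1#-homo; -‿homo)

        inv : Carrier → Carrier
        inv y = proj₁ (surjective y)

        σ-inv : ∀ y → σ $ inv y ≈ y
        σ-inv y = proj₂ (surjective y) ≈-refl

        inv-unique : ∀ {x y} → σ $ x ≈ y → inv y ≈ x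
        inv-unique {x} {y} e = injective (≈-trans (σ-inv y) (≈-sym e))

        inverse′ : Automorphism
        inverse′ = automorphism inv
          (record
            { isRingMonomorphism = record
              { isRingHomomorphism = record
                { isSemiringHomomorphism = record
                  { isNearSemiringHomomorphism = record
                    { +-isMonoidHomomorphism = record
                      { isMagmaHomomorphism = record
                        { isRelHomomorphism = record
                          { cong = λ {x} {y} e → inv-unique (≈-trans (σ-inv y) (≈-sym e)) }
                        ; homo = λ x y → inv-unique (≈-trans (+-homo _ _) (+-cong (σ-inv x) (σ-inv y)))
                        }
                      ; ε-homo = inv-unique 0#-homo
                      }
                    ; *-homo = λ x y → inv-unique (≈-trans (*-homo _ _) (*-cong (σ-inv x) (σ-inv y)))
                    }
                  ; 1#-homo = inv-unique 1#-homo
                  }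
                ; -‿homo = λ x → inv-unique (≈-trans (-‿homo _) (-‿cong (σ-inv x)))
                }
              ; injective = λ {x} {y} e → ≈-trans (≈-sym (σ-inv x)) (≈-trans (⟦⟧-cong e) (σ-inv y))
              }
            ; surjective = λ x → (σ $ x) , λ e → inv-unique (≈-sym e)
            })
          (λ x → inv-unique (fixes σ x))

      -- The Krull topology has the pointwise stabilisers of finite subsets of Kˢ as a neighbourhood basis.

      Fixes : List Carrier → Pred Automorphism (c ⊔ ℓ)
      Fixes xs σ = All (λ x → σ $ x ≈ x) xs

    absoluteGaloisGroup : NonarchimedeanGroup (c ⊔ ℓ) (c ⊔ ℓ) c (c ⊔ ℓ)
    absoluteGaloisGroup = record
      { group = record
        { Carrier = Automorphism
        ; _≈_ = λ σ τ → ∀ x → σ $ x ≈ τ $ x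
        ; _∙_ = _∘′_
        ; ε = identity′
        ; _⁻¹ = inverse′
        ; isGroup = record
          { isMonoid = record
            { isSemigroup = record
              { isMagma = record
                { isEquivalence = record
                  { refl = λ _ → ≈-refl
                  ; sym = λ d x → ≈-sym (d x)
                  ; trans = λ d e x → ≈-trans (d x) (e x)
                  }
                ; ∙-cong = λ {σ} {τ} {σ′} {τ′} d e x → ≈-trans (Automorphism.⟦⟧-cong σ (e x)) (d (τ′ $ x))
                }
              ; assoc = λ _ _ _ _ → ≈-refl
              }
            ; identity = (λ _ _ → ≈-refl) , (λ _ _ → ≈-refl)
            }
          ; inverse = (λ σ x → inv-unique σ ≈-refl) , (λ σ x → σ-inv σ x)
          ; ⁻¹-cong = λ {σ} {τ} d x → inv-unique σ (≈-trans (d _) (σ-inv τ x))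
          }
        }
      ; Basis = List Carrier
      ; U = Fixes
      ; U-resp = λ xs d → All.map (λ {x} e → ≈-trans (≈-sym (d x)) e)
      ; U-ε = λ xs → All.universal (λ _ → ≈-refl) xs
      ; U-∙ = λ { xs {σ} {τ} d e → All.zipWith (λ { {x} (d , e) → ≈-trans (Automorphism.⟦⟧-cong σ e) d }) (d , e) }
      ; U-⁻¹ = λ { xs {σ} d → All.map (λ {x} e → inv-unique σ e) d }
      ; U-∩ = λ xs ys → xs ++ ys , λ d → All.++⁻ˡ xs d , All.++⁻ʳ xs d
      ; U-conj = λ xs σ → map (inv σ) xs , λ {τ} d → All.map
          (λ {x} e → ≈-trans (Automorphism.⟦⟧-cong σ e) (σ-inv σ x)) (All.map⁻ d)
      ; inhabited = []
      }

-- H•(G_K(p), 𝔽ₚ)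

GaloisCohomology : ∀ {c ℓ} (p : ℕ) (K : Field c ℓ) → SeparableClosure K → GradedAlgebra (𝔽 p) (lsuc (c ⊔ ℓ))
GaloisCohomology p K Kˢ = H• (maximalProPQuotient (absoluteGaloisGroup K Kˢ) p) (𝔽 p)

module _ {c ℓ : Level} {p : ℕ} (A : GradedAlgebra (𝔽 p) (lsuc (c ⊔ ℓ))) where

  open GradedAlgebra A

  record LocalModel (W : Subspace (component 1) (lsuc (c ⊔ ℓ))) : Set (lsuc (lsuc (c ⊔ ℓ))) where
    field
      -- The finite set S is Fin ∣S∣.

      ∣S∣ : ℕ
      Kᵥ  : Fin ∣S∣ → Field c ℓ
      Kᵥˢ : ∀ v → SeparableClosure (Kᵥ v)

    Aₛ : GradedAlgebra (𝔽 p) (lsuc (c ⊔ ℓ))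
    Aₛ = Π (λ v → GaloisCohomology p (Kᵥ v) (Kᵥˢ v))

    field
      loc               : GradedHom A Aₛ
      B                 : GradedAlgebra (𝔽 p) (lsuc (c ⊔ ℓ))
      universallyKoszul : IsUniversallyKoszul B
      φ                 : ⌞ A ⟨ W ⟩ ⌟ ≅ B

      -- φ is induced by loc: B is identified with loc(⟨W⟩), and φ with the restriction of loc to ⟨W⟩.

      identification    : B ≅ ⌞ image loc (A ⟨ W ⟩) ⌟
      induced           : ∀ n (x : GradedAlgebra.∣ ⌞ A ⟨ W ⟩ ⌟ ∣ n) →
                          GradedAlgebra._≈_ Aₛ {n}
                            (proj₁ (⟦ proj₁ identification ⟧ {n} (⟦ proj₁ φ ⟧ {n} x))) (⟦ loc ⟧ {n} (proj₁ x))

{-# OPTIONS --safe #-}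
module Submission where

-- The subalgebras ⟨W⟩, for W spanned by finitely many classes of degree 1, form a filtered system: spans are
-- joined by concatenating the spanning families.  Each ⟨W⟩ is isomorphic to the universally Koszul algebra
-- B_W, and universal Koszulity is invariant under isomorphism.  An element of an algebra generated in degree 1
-- involves only finitely many generators, so it lies in some ⟨W⟩.  Indexing the system by spanning families
-- instead of subspaces keeps the index set in the universe of the algebra.

open import Defs
open import Level using (Level; 0ℓ; _⊔_) renaming (suc to lsuc)
open import Algebra.Bundles using (Ring; CommutativeRing)
open import Algebra.Module.Bundles using (LeftModule)
open import Algebra.Module.Morphism.Structures using (module LeftModuleMorphisms)
import Algebra.Module.Morphism.Construct.Composition as Composition
import Algebra.Properties.CommutativeMonoid.Sum as Sum
import Algebra.Properties.Group as GroupProperties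
open import Data.Fin.Base using (zero; suc; _↑ˡ_; _↑ʳ_)
open import Data.Nat using (ℕ; zero; suc)
open import Data.Nat.Primality using (Prime)
open import Data.Product using (Σ; Σ-syntax; _×_; _,_; proj₁; proj₂)
open import Data.Unit.Polymorphic.Base using (tt)
open import Data.Vec.Functional using (Vector; []; _∷_; _++_)
open import Data.Vec.Functional.Properties using (lookup-++ˡ; lookup-++ʳ)
open import Function.Base using (_∘_)
import Function.Construct.Composition as Function
open import Relation.Nullary.Negation using (¬_)

-- Linear maps of modules

module _ {r ℓr : Level} {R : Ring r ℓr} where

  private
    module R = Ring R

  module _ {m ℓm n ℓn : Level} (M : LeftModule R m ℓm) (N : LeftModule R n ℓn) where

    private
      module M = LeftModule M
      module N = LeftModule N
      module ΣM = Sum M.+ᴹ-commutativeMonoid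
      module ΣN = Sum N.+ᴹ-commutativeMonoid

    IsLinear : (M.Carrierᴹ → N.Carrierᴹ) → Set _
    IsLinear = LeftModuleMorphisms.IsLeftModuleHomomorphism M.rawLeftModule N.rawLeftModule

    -- Zero is a scalar multiple by zero, so homogeneity gives preservation of zero; preservation of
    -- negatives then follows from additivity and uniqueness of inverses.
    isLinear : {f : M.Carrierᴹ → N.Carrierᴹ} →
               (∀ {x y} → x M.≈ᴹ y → f x N.≈ᴹ f y) →
               (∀ x y → f (x M.+ᴹ y) N.≈ᴹ f x N.+ᴹ f y) →
               (∀ c x → f (c M.*ₗ x) N.≈ᴹ c N.*ₗ f x) → IsLinear f
    isLinear {f} f-cong f-+ f-* = record
      { +ᴹ-isGroupHomomorphism = record
        { isMonoidHomomorphism = record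
          { isMagmaHomomorphism = record { isRelHomomorphism = record { cong = f-cong } ; homo = f-+ }
          ; ε-homo = f-0
          }
        ; ⁻¹-homo = λ x → GroupProperties.inverseˡ-unique N.+ᴹ-group _ _
            (N.≈ᴹ-trans (N.≈ᴹ-sym (f-+ (M.-ᴹ x) x)) (N.≈ᴹ-trans (f-cong (M.-ᴹ‿inverseˡ x)) f-0))
        }
      ; *ₗ-homo = f-*
      }
      where
      f-0 : f M.0ᴹ N.≈ᴹ N.0ᴹ
      f-0 = N.≈ᴹ-trans (f-cong (M.≈ᴹ-sym (M.*ₗ-zeroˡ M.0ᴹ))) (N.≈ᴹ-trans (f-* R.0# M.0ᴹ) (N.*ₗ-zeroˡ _))

    module _ {f : M.Carrierᴹ → N.Carrierᴹ} (lin : IsLinear f) where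

      open LeftModuleMorphisms.IsLeftModuleHomomorphism lin

      sum-homo : ∀ {n} (v : Vector M.Carrierᴹ n) → f (ΣM.sum v) N.≈ᴹ ΣN.sum (f ∘ v)
      sum-homo {zero}  v = 0ᴹ-homo
      sum-homo {suc n} v = N.≈ᴹ-trans (+ᴹ-homo _ _) (N.+ᴹ-congˡ (sum-homo (v ∘ suc)))

      combination-homo : ∀ {n} (c : Vector R.Carrier n) (v : Vector M.Carrierᴹ n) →
                         f (ΣM.sum (λ i → c i M.*ₗ v i)) N.≈ᴹ ΣN.sum (λ i → c i N.*ₗ f (v i))
      combination-homo c v = N.≈ᴹ-trans (sum-homo (λ i → c i M.*ₗ v i)) (ΣN.sum-cong-≋ (λ i → *ₗ-homo (c i) (v i)))

      preimage : {s : Level} → Subspace N s → Subspace M s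
      preimage P = record
        { _∋_ = λ x → P ∋ f x
        ; resp = λ e → Subspace.resp P (⟦⟧-cong e)
        ; 0∈ = Subspace.resp P (N.≈ᴹ-sym 0ᴹ-homo) (Subspace.0∈ P)
        ; +∈ = λ {x} {y} x∈ y∈ → Subspace.resp P (N.≈ᴹ-sym (+ᴹ-homo x y)) (Subspace.+∈ P x∈ y∈)
        ; *∈ = λ c {x} x∈ → Subspace.resp P (N.≈ᴹ-sym (*ₗ-homo c x)) (Subspace.*∈ P c x∈)
        }

      -- The image of a spanning family spans. As `FiniteDimensional` asks for no linear
      -- independence, the same number of vectors serves.
      surjective⇒finiteDimensional : (∀ y → Σ[ x ∈ M.Carrierᴹ ] f x N.≈ᴹ y) →
                                     FiniteDimensional M → FiniteDimensional N
      surjective⇒finiteDimensional surj (n , v , spans) = n , f ∘ v , λ y →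
        let x , fx≈y = surj y ; c , x≈ = spans x in
        c , N.≈ᴹ-trans (N.≈ᴹ-sym fx≈y) (N.≈ᴹ-trans (⟦⟧-cong x≈) (combination-homo c v))

module _ {k : CommutativeRing 0ℓ 0ℓ} where

  private
    module k = CommutativeRing k

  -- Spans of finite families

  module _ {m ℓm : Level} (M : LeftModule k.ring m ℓm) where

    private
      module M = LeftModule M
      open M using (Carrierᴹ; _≈ᴹ_; _+ᴹ_; _*ₗ_; 0ᴹ)
      open Sum M.+ᴹ-commutativeMonoid

    -- Compatibility with a second scalar rests on commutativity of `k`. The lemma lets a scalar be
    -- moved inside a linear combination.
    *ₗ-isLinear : ∀ c → IsLinear M M (c *ₗ_)
    *ₗ-isLinear c = isLinear M M M.*ₗ-congˡ (M.*ₗ-distribˡ c) (λ d x →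
      M.≈ᴹ-trans (M.≈ᴹ-sym (M.*ₗ-assoc c d x)) (M.≈ᴹ-trans (M.*ₗ-congʳ (k.*-comm c d)) (M.*ₗ-assoc d c x)))

    -- Membership consists of coefficients in `k`, which lives at level `0ℓ`, and an equation in
    -- `M`. Hence the span of a family in degree 1 has the level that `_⟨_⟩` requires.
    span : ∀ {n} → Vector Carrierᴹ n → Subspace M ℓm
    span {n} v = record
      { _∋_ = λ x → Σ[ c ∈ Vector k.Carrier n ] x ≈ᴹ sum (λ i → c i *ₗ v i)
      ; resp = λ { e (c , x≈) → c , M.≈ᴹ-trans (M.≈ᴹ-sym e) x≈ }
      ; 0∈ = (λ _ → k.0#) , M.≈ᴹ-sym
          (M.≈ᴹ-trans (sum-cong-≋ (λ i → M.*ₗ-zeroˡ (v i))) (sum-replicate-zero n))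
      ; +∈ = λ { (c , x≈) (d , y≈) → (λ i → c i k.+ d i) ,
          M.≈ᴹ-trans (M.+ᴹ-cong x≈ y≈) (M.≈ᴹ-sym
          (M.≈ᴹ-trans (sum-cong-≋ (λ i → M.*ₗ-distribʳ (v i) (c i) (d i)))
            (∑-distrib-+ (λ i → c i *ₗ v i) (λ i → d i *ₗ v i)))) }
      ; *∈ = λ { d (c , x≈) → (λ i → d k.* c i) ,
          M.≈ᴹ-trans (M.*ₗ-congˡ x≈)
          (M.≈ᴹ-trans (sum-homo M M (*ₗ-isLinear d) (λ i → c i *ₗ v i))
            (sum-cong-≋ (λ i → M.≈ᴹ-sym (M.*ₗ-assoc d (c i) (v i))))) }
      }

    -- The coefficients are the `i`-th standard unit vector, built by recursion on `i`.
    ∈span : ∀ {n} (v : Vector Carrierᴹ n) i → span v ∋ v i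
    ∈span {suc n} v zero = (k.1# ∷ λ _ → k.0#) , M.≈ᴹ-sym
      (M.≈ᴹ-trans (M.+ᴹ-cong (M.*ₗ-identityˡ (v zero))
        (M.≈ᴹ-trans (sum-cong-≋ (λ i → M.*ₗ-zeroˡ (v (suc i)))) (sum-replicate-zero n)))
        (M.+ᴹ-identityʳ (v zero)))
    ∈span v (suc i) = let c , v≈ = ∈span (v ∘ suc) i in k.0# ∷ c , M.≈ᴹ-sym
      (M.≈ᴹ-trans (M.+ᴹ-cong (M.*ₗ-zeroˡ (v zero)) (M.≈ᴹ-sym v≈)) (M.+ᴹ-identityˡ (v (suc i))))

    module _ {s : Level} (P : Subspace M s) where

      open Subspace P using (resp; 0∈; +∈; *∈)

      sum∈ : ∀ {n} {v : Vector Carrierᴹ n} → (∀ i → P ∋ v i) → P ∋ sum v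
      sum∈ {zero}  v∈ = 0∈
      sum∈ {suc n} v∈ = +∈ (v∈ zero) (sum∈ (v∈ ∘ suc))

      span-least : ∀ {n} {v : Vector Carrierᴹ n} → (∀ i → P ∋ v i) → span v ⊆ₛ P
      span-least v∈ (c , x≈) = resp (M.≈ᴹ-sym x≈) (sum∈ (λ i → *∈ (c i) (v∈ i)))

      inclusion-isLinear : IsLinear (submodule M P) M proj₁
      inclusion-isLinear = isLinear (submodule M P) M (λ e → e) (λ _ _ → M.≈ᴹ-refl) (λ _ _ → M.≈ᴹ-refl)

    span-++ˡ : ∀ {n o} (v : Vector Carrierᴹ n) (w : Vector Carrierᴹ o) → span v ⊆ₛ span (v ++ w)
    span-++ˡ {o = o} v w = span-least (span (v ++ w)) λ i →
      Subspace.resp (span (v ++ w)) (M.≈ᴹ-reflexive (lookup-++ˡ v w i)) (∈span (v ++ w) (i ↑ˡ o))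

    span-++ʳ : ∀ {n o} (v : Vector Carrierᴹ n) (w : Vector Carrierᴹ o) → span w ⊆ₛ span (v ++ w)
    span-++ʳ {n} v w = span-least (span (v ++ w)) λ i →
      Subspace.resp (span (v ++ w)) (M.≈ᴹ-reflexive (lookup-++ʳ v w i)) (∈span (v ++ w) (n ↑ʳ i))

    -- The required sum is formed in the submodule; linearity of the inclusion compares it with the
    -- sum in `M`, so the coefficients stored in the membership proof can be reused.
    span-finiteDimensional : ∀ {n} (v : Vector Carrierᴹ n) → FiniteDimensional (submodule M (span v))
    span-finiteDimensional {n} v = n , v′ , λ { (x , c , x≈) → c ,
      M.≈ᴹ-trans x≈ (M.≈ᴹ-sym (combination-homo (submodule M (span v)) M (inclusion-isLinear (span v)) c v′)) }
      where
      v′ : Vector (Σ Carrierᴹ (span v ∋_)) n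
      v′ i = v i , ∈span v i

    finiteDimensional⇒⊆span : {s : Level} (P : Subspace M s) ((n , v , _) : FiniteDimensional (submodule M P)) →
                              P ⊆ₛ span (proj₁ ∘ v)
    finiteDimensional⇒⊆span P (n , v , spans) {x} x∈ = let c , x≈ = spans (x , x∈) in
      c , M.≈ᴹ-trans x≈ (combination-homo (submodule M P) M (inclusion-isLinear P) c v)

  -- Graded homomorphisms

  module Hom {a b : Level} {A : GradedAlgebra k a} {B : GradedAlgebra k b} (f : GradedHom A B) where
    open GradedHom f public using (homo; 1-homo)
    module _ {n : ℕ} where
      open LeftModuleMorphisms.IsLeftModuleHomomorphism (GradedHom.isLeftModuleHomomorphism f n) public

  module _ {a b : Level} {A : GradedAlgebra k a} {B : GradedAlgebra k b} where

    private
      module A = GradedAlgebra A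
      module B = GradedAlgebra B

    inverses⇒≅ : (f : GradedHom A B) (g : GradedHom B A) →
                 (∀ {n} (x : A.∣ n ∣) → ⟦ g ⟧ (⟦ f ⟧ x) A.≈ x) →
                 (∀ {n} (y : B.∣ n ∣) → ⟦ f ⟧ (⟦ g ⟧ y) B.≈ y) → A ≅ B
    inverses⇒≅ f g gf fg = f , λ n →
      (λ {x} {y} e → A.≈-trans (A.≈-sym (gf x)) (A.≈-trans (Hom.⟦⟧-cong g e) (gf y))) ,
      (λ y → ⟦ g ⟧ y , λ e → B.≈-trans (Hom.⟦⟧-cong f e) (fg y))

    module Iso (iso : A ≅ B) where

      f : GradedHom A B
      f = proj₁ iso

      f-injective : ∀ {n} {x y : A.∣ n ∣} → ⟦ f ⟧ x B.≈ ⟦ f ⟧ y → x A.≈ y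
      f-injective {n} = proj₁ (proj₂ iso n)

      private
        from : ∀ {n} → B.∣ n ∣ → A.∣ n ∣
        from {n} y = proj₁ (proj₂ (proj₂ iso n) y)

        f-from : ∀ {n} (y : B.∣ n ∣) → ⟦ f ⟧ (from y) B.≈ y
        f-from {n} y = proj₂ (proj₂ (proj₂ iso n) y) A.≈-refl

        -- Since `f` is injective, equations about the inverse can be checked after applying `f`.
        -- Every law of `g` below reduces to this.
        from-unique : ∀ {n} {x : A.∣ n ∣} {y : B.∣ n ∣} → ⟦ f ⟧ x B.≈ y → from y A.≈ x
        from-unique {y = y} e = f-injective (B.≈-trans (f-from y) (B.≈-sym e))

      g : GradedHom B A
      g = record
        { ⟦_⟧ = from
        ; isLeftModuleHomomorphism = λ n → isLinear (B.component n) (A.component n)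
            (λ {x} {y} e → from-unique (B.≈-trans (f-from y) (B.≈-sym e)))
            (λ x y → from-unique (B.≈-trans (Hom.+ᴹ-homo f _ _) (B.C.+ᴹ-cong n (f-from x) (f-from y))))
            (λ c x → from-unique (B.≈-trans (Hom.*ₗ-homo f c _) (B.C.*ₗ-congˡ n (f-from x))))
        ; homo = λ e x y → from-unique (B.≈-trans (Hom.homo f e _ _) (B.mul-cong e (f-from x) (f-from y)))
        ; 1-homo = from-unique (Hom.1-homo f)
        }

      fg : ∀ {n} (y : B.∣ n ∣) → ⟦ f ⟧ (⟦ g ⟧ y) B.≈ y
      fg = f-from

      gf : ∀ {n} (x : A.∣ n ∣) → ⟦ g ⟧ (⟦ f ⟧ x) A.≈ x
      gf x = from-unique B.≈-refl

  ≅-trans : {a b c : Level} {A : GradedAlgebra k a} {B : GradedAlgebra k b} {C : GradedAlgebra k c} →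
            A ≅ B → B ≅ C → A ≅ C
  ≅-trans {A = A} {B} {C} (f , bij) (h , bij′) = record
      { ⟦_⟧ = ⟦ h ⟧ ∘ ⟦ f ⟧
      ; isLeftModuleHomomorphism = λ n → Composition.isLeftModuleHomomorphism C.≈-trans
          (GradedHom.isLeftModuleHomomorphism f n) (GradedHom.isLeftModuleHomomorphism h n)
      ; homo = λ e x y → C.≈-trans (Hom.⟦⟧-cong h (Hom.homo f e x y)) (Hom.homo h e _ _)
      ; 1-homo = C.≈-trans (Hom.⟦⟧-cong h (Hom.1-homo f)) (Hom.1-homo h)
      } ,
    λ n → Function.bijective (GradedAlgebra._≈_ A {n}) (GradedAlgebra._≈_ B) C._≈_ (bij n) (bij′ n)
    where module C = GradedAlgebra C

  -- Generated subalgebras, left ideals and quotients under homomorphisms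

  module _ {a : Level} {A : GradedAlgebra k a} where

    open GradedAlgebra A

    ⟨⟩-mono : {W W′ : Subspace (component 1) a} → W ⊆ₛ W′ → A ⟨ W ⟩ ≤ A ⟨ W′ ⟩
    ⟨⟩-mono W⊆W′ n (gen x∈)       = gen (W⊆W′ x∈)
    ⟨⟩-mono W⊆W′ n one            = one
    ⟨⟩-mono W⊆W′ n (mult e x∈ y∈) = mult e (⟨⟩-mono W⊆W′ _ x∈) (⟨⟩-mono W⊆W′ _ y∈)
    ⟨⟩-mono W⊆W′ n null           = null
    ⟨⟩-mono W⊆W′ n (plus x∈ y∈)   = plus (⟨⟩-mono W⊆W′ n x∈) (⟨⟩-mono W⊆W′ n y∈)
    ⟨⟩-mono W⊆W′ n (scale c x∈)   = scale c (⟨⟩-mono W⊆W′ n x∈)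
    ⟨⟩-mono W⊆W′ n (equal e x∈)   = equal e (⟨⟩-mono W⊆W′ n x∈)

  module _ {a : Level} {A B : GradedAlgebra k a} (f : GradedHom A B) where

    private
      module A = GradedAlgebra A
      module B = GradedAlgebra B
      module f = Hom f
      open GradedHom f using (isLeftModuleHomomorphism)

    Generated-map : {W : Subspace (A.component 1) a} {W′ : Subspace (B.component 1) a} →
                    (∀ {x} → W ∋ x → W′ ∋ ⟦ f ⟧ x) →
                    ∀ {n} {x : A.∣ n ∣} → Generated A W x → Generated B W′ (⟦ f ⟧ x)
    Generated-map h (gen x∈)       = gen (h x∈)
    Generated-map h one            = equal (B.≈-sym f.1-homo) one
    Generated-map h (mult e x∈ y∈) = equal (B.≈-sym (f.homo e _ _)) (mult e (Generated-map h x∈) (Generated-map h y∈))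
    Generated-map h null           = equal (B.≈-sym f.0ᴹ-homo) null
    Generated-map h (plus x∈ y∈)   = equal (B.≈-sym (f.+ᴹ-homo _ _)) (plus (Generated-map h x∈) (Generated-map h y∈))
    Generated-map h (scale c x∈)   = equal (B.≈-sym (f.*ₗ-homo c _)) (scale c (Generated-map h x∈))
    Generated-map h (equal e x∈)   = equal (f.⟦⟧-cong e) (Generated-map h x∈)

    InSpan-map : {I₁ : Subspace (A.component 1) a} {J₁ : Subspace (B.component 1) a} →
                 (∀ {x} → I₁ ∋ x → J₁ ∋ ⟦ f ⟧ x) →
                 ∀ {n} {x : A.∣ n ∣} → InSpan A I₁ x → InSpan B J₁ (⟦ f ⟧ x)
    InSpan-map h (mult e x y∈) = equal (B.≈-sym (f.homo e x _)) (mult e (⟦ f ⟧ x) (h y∈))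
    InSpan-map h null          = equal (B.≈-sym f.0ᴹ-homo) null
    InSpan-map h (plus x∈ y∈)  = equal (B.≈-sym (f.+ᴹ-homo _ _)) (plus (InSpan-map h x∈) (InSpan-map h y∈))
    InSpan-map h (equal e x∈)  = equal (f.⟦⟧-cong e) (InSpan-map h x∈)

    preimageIdeal : LeftIdeal B → LeftIdeal A
    preimageIdeal J = record
      { part = λ n → preimage (A.component n) (B.component n) (isLeftModuleHomomorphism n) (part n)
      ; mul∈ = λ {_} {_} {l} e x y∈ → Subspace.resp (part l) (B.≈-sym (f.homo e x _)) (mul∈ e (⟦ f ⟧ x) y∈)
      }
      where open LeftIdeal J

    module _ {R : Subspace (A.component 2) a} {R′ : Subspace (B.component 2) a}
             (R⇒R′ : ∀ {x} → R ∋ x → R′ ∋ ⟦ f ⟧ x) where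

      InIdeal-map : ∀ {n} {x : A.∣ n ∣} → InIdeal A R x → InIdeal B R′ (⟦ f ⟧ x)
      InIdeal-map (gen x∈)       = gen (R⇒R′ x∈)
      InIdeal-map (multˡ e x y∈) = equal (B.≈-sym (f.homo e x _)) (multˡ e (⟦ f ⟧ x) (InIdeal-map y∈))
      InIdeal-map (multʳ e y x∈) = equal (B.≈-sym (f.homo e _ y)) (multʳ e (⟦ f ⟧ y) (InIdeal-map x∈))
      InIdeal-map null           = equal (B.≈-sym f.0ᴹ-homo) null
      InIdeal-map (plus x∈ y∈)   = equal (B.≈-sym (f.+ᴹ-homo _ _)) (plus (InIdeal-map x∈) (InIdeal-map y∈))
      InIdeal-map (scale c x∈)   = equal (B.≈-sym (f.*ₗ-homo c _)) (scale c (InIdeal-map x∈))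
      InIdeal-map (equal e x∈)   = equal (f.⟦⟧-cong e) (InIdeal-map x∈)

      quotientHom : GradedHom (A / idealGeneratedBy A R) (B / idealGeneratedBy B R′)
      quotientHom = record
        { ⟦_⟧ = ⟦ f ⟧
        ; isLeftModuleHomomorphism = λ n → isLinear
            (GradedAlgebra.component (A / idealGeneratedBy A R) n)
            (GradedAlgebra.component (B / idealGeneratedBy B R′) n)
            -- Equality in the quotient is membership of `x + - y` in the ideal, and `f` takes this
            -- difference to the difference of the images.
            (λ d → equal (B.≈-trans (f.+ᴹ-homo _ _) (B.C.+ᴹ-congˡ n (f.-ᴹ-homo _))) (InIdeal-map d))
            (λ x y → ≈⇒/ (f.+ᴹ-homo x y))
            (λ c x → ≈⇒/ (f.*ₗ-homo c x))
        ; homo = λ e x y → ≈⇒/ (f.homo e x y)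
        ; 1-homo = ≈⇒/ f.1-homo
        }
        where
        ≈⇒/ : ∀ {n} {x y : B.∣ n ∣} → x B.≈ y → GradedAlgebra._≈_ (B / idealGeneratedBy B R′) {n} x y
        ≈⇒/ {n} = quotient-≈ (B.component n) (Ideal.part (idealGeneratedBy B R′) n)

  -- The universal property of the tensor algebra

  module _ {a : Level} (V : LeftModule k.ring a a) (A : GradedAlgebra k a) where

    private
      module V = LeftModule V
      open GradedAlgebra A

    module _ {φ : V.Carrierᴹ → ∣ 1 ∣} (lin : IsLinear V (component 1) φ) where

      open LeftModuleMorphisms.IsLeftModuleHomomorphism lin

      extend : ∀ {n} → Tensor {k} V n → ∣ n ∣
      extend (gen x)      = φ x
      extend one          = 1#
      extend (mult e x y) = mul e (extend x) (extend y)
      extend null         = 0#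
      extend (x ⊕ y)      = extend x + extend y
      extend (⊖ x)        = - extend x
      extend (c ⊙ x)      = c *ₗ extend x

      -- Each constructor of `_≋_` is a closure rule of a congruence, linearity of the generators,
      -- which `lin` provides, or an algebra law, which holds in `A`.
      extend-cong : ∀ {n} {x y : Tensor {k} V n} → _≋_ {k} V x y → extend x ≈ extend y
      extend-cong     ≋-refl                     = ≈-refl
      extend-cong     (≋-sym d)                  = ≈-sym (extend-cong d)
      extend-cong     (≋-trans d e)              = ≈-trans (extend-cong d) (extend-cong e)
      extend-cong     (gen-cong d)               = ⟦⟧-cong d
      extend-cong     (gen-+ x y)                = +ᴹ-homo x y
      extend-cong     (gen-* c x)                = *ₗ-homo c x
      extend-cong {n} (⊕-cong d e)               = C.+ᴹ-cong n (extend-cong d) (extend-cong e)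
      extend-cong {n} (⊖-cong d)                 = C.-ᴹ‿cong n (extend-cong d)
      extend-cong {n} (⊕-assoc x y z)            = C.+ᴹ-assoc n _ _ _
      extend-cong {n} (⊕-comm x y)               = C.+ᴹ-comm n _ _
      extend-cong {n} (⊕-identityˡ x)            = C.+ᴹ-identityˡ n _
      extend-cong {n} (⊕-inverseˡ x)             = C.-ᴹ‿inverseˡ n _
      extend-cong {n} (⊙-cong c d)               = C.*ₗ-cong n c (extend-cong d)
      extend-cong {n} (⊙-distribʳ x c d)         = C.*ₗ-distribʳ n _ c d
      extend-cong {n} (⊙-distribˡ c x y)         = C.*ₗ-distribˡ n c _ _
      extend-cong {n} (⊙-identityˡ x)            = C.*ₗ-identityˡ n _
      extend-cong {n} (⊙-assoc c d x)            = C.*ₗ-assoc n c d _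
      extend-cong     (mult-cong e d d′)         = mul-cong e (extend-cong d) (extend-cong d′)
      extend-cong     (mult-distribˡ e x y z)    = distribˡ e _ _ _
      extend-cong     (mult-distribʳ e x y z)    = distribʳ e _ _ _
      extend-cong     (⊙-mult e c x y)           = *ₗ-mul e c _ _
      extend-cong     (mult-⊙ e c x y)           = mul-*ₗ e c _ _
      extend-cong     (mult-identityˡ e x)       = identityˡ e _
      extend-cong     (mult-identityʳ e x)       = identityʳ e _
      extend-cong     (mult-assoc e f g h x y z) = assoc e f g h _ _ _

      extendHom : GradedHom (TensorAlgebra {k} V) A
      extendHom = record
        { ⟦_⟧ = extend
        ; isLeftModuleHomomorphism = λ n → isLinear
            (GradedAlgebra.component (TensorAlgebra {k} V) n) (component n)
            extend-cong (λ _ _ → ≈-refl) (λ _ _ → ≈-refl)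
        ; homo = λ _ _ _ → ≈-refl
        ; 1-homo = ≈-refl
        }

  module _ {a : Level} (V W : LeftModule k.ring a a) where

    private
      module V = LeftModule V
      module W = LeftModule W

    tensorMap : {φ : V.Carrierᴹ → W.Carrierᴹ} → IsLinear V W φ →
                GradedHom (TensorAlgebra {k} V) (TensorAlgebra {k} W)
    tensorMap {φ} lin = extendHom V (TensorAlgebra {k} W) {φ = gen ∘ φ} (isLinear V T₁
      (λ e → gen-cong (⟦⟧-cong e))
      (λ x y → ≋-trans (gen-cong (+ᴹ-homo x y)) (gen-+ _ _))
      (λ c x → ≋-trans (gen-cong (*ₗ-homo c x)) (gen-* c _)))
      where
      T₁ : LeftModule k.ring a a
      T₁ = GradedAlgebra.component (TensorAlgebra {k} W) 1
      open LeftModuleMorphisms.IsLeftModuleHomomorphism lin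

  module _ {a : Level} (V W : LeftModule k.ring a a) where

    private
      module V = LeftModule V
      module W = LeftModule W

    -- Both maps act by recursion on terms and alter only the generators, so the composite rebuilds
    -- the term and the hypothesis is applied at its leaves.
    tensorMap-inverse : {φ : V.Carrierᴹ → W.Carrierᴹ} {ψ : W.Carrierᴹ → V.Carrierᴹ}
                        (lin : IsLinear V W φ) (lin′ : IsLinear W V ψ) → (∀ x → ψ (φ x) V.≈ᴹ x) →
                        ∀ {n} (x : Tensor {k} V n) → _≋_ {k} V (⟦ tensorMap W V lin′ ⟧ (⟦ tensorMap V W lin ⟧ x)) x
    tensorMap-inverse lin lin′ inv = go
      where
      go : ∀ {n} (x : Tensor {k} V n) → _≋_ {k} V (⟦ tensorMap W V lin′ ⟧ (⟦ tensorMap V W lin ⟧ x)) x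
      go (gen x)      = gen-cong (inv x)
      go one          = ≋-refl
      go (mult e x y) = mult-cong e (go x) (go y)
      go null         = ≋-refl
      go (x ⊕ y)      = ⊕-cong (go x) (go y)
      go (⊖ x)        = ⊖-cong (go x)
      go (c ⊙ x)      = ⊙-cong k.refl (go x)

  -- Invariance of universal Koszulity under isomorphism

  module _ {a : Level} {A B : GradedAlgebra k a} (iso : A ≅ B) where

    private
      module A = GradedAlgebra A
      module B = GradedAlgebra B
      open Iso iso
      module f = Hom f
      module g = Hom g

    -- In degree 0, `f` carries the unit map of `A` to that of `B`, so injectivity and surjectivity
    -- of the latter transfer.
    ≅-connected : Connected B → Connected A
    ≅-connected (inj , surj) =
      (λ {c} {d} e → inj (B.≈-trans (B.≈-sym (f-unit c)) (B.≈-trans (f.⟦⟧-cong e) (f-unit d)))) ,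
      (λ x → let c , c1≈ = surj (⟦ f ⟧ x) in c , λ {d} e → f-injective (B.≈-trans (f-unit d) (c1≈ e)))
      where
      f-unit : ∀ c → ⟦ f ⟧ (c A.*ₗ A.1#) B.≈ c B.*ₗ B.1#
      f-unit c = B.≈-trans (f.*ₗ-homo c A.1#) (B.C.*ₗ-congˡ 0 f.1-homo)

    -- The degree 1 part of the isomorphism induces an isomorphism of tensor algebras. Pulling the
    -- relations of `B` back along it makes the two quotients isomorphic, and the presentation of
    -- `A` passes through `B` and the quotient presenting `B`.
    ≅-isQuadratic : IsQuadratic B → IsQuadratic A
    ≅-isQuadratic quadratic = record
      { connected = ≅-connected connected
      -- Up to equality `x` is `g` of `f x`, and `g` carries a derivation that generates `f x` from
      -- degree 1 to one in `A`.
      ; generatedInDegree1 = λ n x → equal (gf x) (Generated-map g (λ _ → tt) (generatedInDegree1 n (⟦ f ⟧ x)))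
      ; relations = relations′
      ; presentation = ≅-trans iso (≅-trans presentation (inverses⇒≅ T/g T/f
          (λ x → quotient-≈ (TB.component _) (Ideal.part (idealGeneratedBy TB relations) _) (TfTg x))
          (λ x → quotient-≈ (TA.component _) (Ideal.part (idealGeneratedBy TA relations′) _) (TgTf x))))
      }
      where
      open IsQuadratic quadratic

      TA TB : GradedAlgebra k a
      TA = TensorAlgebra (A.component 1)
      TB = TensorAlgebra (B.component 1)
      module TA = GradedAlgebra TA
      module TB = GradedAlgebra TB

      f₁ = GradedHom.isLeftModuleHomomorphism f 1
      g₁ = GradedHom.isLeftModuleHomomorphism g 1

      Tf : GradedHom TA TB
      Tf = tensorMap (A.component 1) (B.component 1) f₁

      Tg : GradedHom TB TA
      Tg = tensorMap (B.component 1) (A.component 1) g₁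

      TfTg : ∀ {n} (x : TB.∣ n ∣) → ⟦ Tf ⟧ (⟦ Tg ⟧ x) TB.≈ x
      TfTg = tensorMap-inverse (B.component 1) (A.component 1) g₁ f₁ fg

      TgTf : ∀ {n} (x : TA.∣ n ∣) → ⟦ Tg ⟧ (⟦ Tf ⟧ x) TA.≈ x
      TgTf = tensorMap-inverse (A.component 1) (B.component 1) f₁ g₁ gf

      relations′ : Subspace (TA.component 2) a
      relations′ = preimage (TA.component 2) (TB.component 2) (GradedHom.isLeftModuleHomomorphism Tf 2) relations

      T/f : GradedHom (TA / idealGeneratedBy TA relations′) (TB / idealGeneratedBy TB relations)
      T/f = quotientHom Tf (λ x∈ → x∈)

      T/g : GradedHom (TB / idealGeneratedBy TB relations) (TA / idealGeneratedBy TA relations′)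
      -- As `relations′` is a preimage under `Tf`, the condition on `Tg` concerns the image of `x`
      -- under `Tf` after `Tg`, which is equal to `x`.
      T/g = quotientHom Tg (λ {x} → Subspace.resp relations (TB.≈-sym (TfTg x)))

    -- For the colon condition, a left ideal of `A` is pulled back along `g` to `B`; the condition
    -- holds there, and `g` brings the resulting expression back to `A`.
    ≅-isUniversallyKoszul : IsUniversallyKoszul B → IsUniversallyKoszul A
    ≅-isUniversallyKoszul koszul = record
      { isQuadratic = ≅-isQuadratic isQuadratic
      ; finiteType = surjective⇒finiteDimensional (B.component 1) (A.component 1)
          (GradedHom.isLeftModuleHomomorphism g 1) (λ x → ⟦ f ⟧ x , gf x) finiteType
      ; colon∈𝓛 = colon∈𝓛′
      }
      where
      open IsUniversallyKoszul koszul
      open LeftIdeal using (part)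

      colon∈𝓛′ : ∀ I → _∈𝓛 A I → ∀ x → ¬ part I 1 ∋ x → _∈𝓛 A (colon A I x)
      -- The element `f y` lies in the colon ideal of `J` by `f x`, so it is a combination of degree
      -- 1 elements of that ideal. `g` maps these into the colon ideal of `I` by `x`, and `f y` back
      -- to `y`. Likewise, `f x` in `J` would put `x` in `I`.
      colon∈𝓛′ I I∈𝓛 x x∉I {n} {y} yx∈I = equal (gf y)
        (InSpan-map g colon-g (colon∈𝓛 J J∈𝓛 (⟦ f ⟧ x) (x∉I ∘ resp 1 (gf x))
          (resp (suc n) (A.≈-sym (g-mul-f y)) yx∈I)))
        where
        resp : ∀ n {y z} → y A.≈ z → part I n ∋ y → part I n ∋ z
        resp n = Subspace.resp (part I n)

        J : LeftIdeal B
        J = preimageIdeal g I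

        J∈𝓛 : _∈𝓛 B J
        -- Here `g z` is in `I`, hence in the span of its degree 1 part. Applying `f`, which sends
        -- that part into `J`, recovers `z`.
        J∈𝓛 {x = z} z∈ = equal (fg z) (InSpan-map f (λ {u} → resp 1 (A.≈-sym (gf u))) (I∈𝓛 z∈))

        g-mul : ∀ {n} (z : B.∣ n ∣) → ⟦ g ⟧ (B.mul (∔-1 n) z (⟦ f ⟧ x)) A.≈ A.mul (∔-1 n) (⟦ g ⟧ z) x
        g-mul {n} z = A.≈-trans (g.homo (∔-1 n) z (⟦ f ⟧ x)) (A.mul-cong (∔-1 n) A.≈-refl (gf x))

        g-mul-f : ∀ {n} (z : A.∣ n ∣) → ⟦ g ⟧ (B.mul (∔-1 n) (⟦ f ⟧ z) (⟦ f ⟧ x)) A.≈ A.mul (∔-1 n) z x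
        g-mul-f {n} z = A.≈-trans (g-mul (⟦ f ⟧ z)) (A.mul-cong (∔-1 n) (gf z) A.≈-refl)

        colon-g : ∀ {z} → part (colon B J (⟦ f ⟧ x)) 1 ∋ z → part (colon A I x) 1 ∋ ⟦ g ⟧ z
        colon-g {z} = resp 2 (g-mul z)

  -- The filtered system of subalgebras generated by finitely many elements of degree 1

  module _ {a : Level} (A : GradedAlgebra k a) where

    open GradedAlgebra A

    private
      Index : Set a
      Index = Σ[ n ∈ ℕ ] Vector ∣ 1 ∣ n

      spanOf : Index → Subspace (component 1) a
      spanOf (_ , v) = span (component 1) v

      _⊔ᵢ_ : Index → Index → Index
      (_ , v) ⊔ᵢ (_ , w) = _ , v ++ w

      inl : ∀ i j → A ⟨ spanOf i ⟩ ≤ A ⟨ spanOf (i ⊔ᵢ j) ⟩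
      inl (_ , v) (_ , w) = ⟨⟩-mono (span-++ˡ (component 1) v w)

      inr : ∀ i j → A ⟨ spanOf j ⟩ ≤ A ⟨ spanOf (i ⊔ᵢ j) ⟩
      inr (_ , v) (_ , w) = ⟨⟩-mono (span-++ʳ (component 1) v w)

    finitelyGenerated : FilteredSystem A
    finitelyGenerated = record
      { Index = Index
      ; inhabited = 0 , []
      ; member = λ i → A ⟨ spanOf i ⟩
      ; directed = λ i j → i ⊔ᵢ j , inl i j , inr i j
      }

    open FilteredSystem finitelyGenerated using (member)
    open Subalgebra using (part)

    -- Induction on the derivation: a generator contributes a one-element family, constants the
    -- empty one, and sums and products move both operands to the joined family.
    Generated⇒finitelyGenerated : {W : Subspace (component 1) a} →
      ∀ {n} {x : ∣ n ∣} → Generated A W x → Σ[ i ∈ Index ] part (member i) n ∋ x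
    Generated⇒finitelyGenerated (gen {x} _) = (1 , λ _ → x) , gen (∈span (component 1) (λ _ → x) zero)
    Generated⇒finitelyGenerated one = (0 , []) , one
    Generated⇒finitelyGenerated (mult e x∈ y∈) =
      let i , x∈i = Generated⇒finitelyGenerated x∈ ; j , y∈j = Generated⇒finitelyGenerated y∈ in
      i ⊔ᵢ j , mult e (inl i j _ x∈i) (inr i j _ y∈j)
    Generated⇒finitelyGenerated null = (0 , []) , null
    Generated⇒finitelyGenerated (plus x∈ y∈) =
      let i , x∈i = Generated⇒finitelyGenerated x∈ ; j , y∈j = Generated⇒finitelyGenerated y∈ in
      i ⊔ᵢ j , plus (inl i j _ x∈i) (inr i j _ y∈j)
    Generated⇒finitelyGenerated (scale c x∈) =
      let i , x∈i = Generated⇒finitelyGenerated x∈ in i , scale c x∈i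
    Generated⇒finitelyGenerated (equal e x∈) =
      let i , x∈i = Generated⇒finitelyGenerated x∈ in i , equal e x∈i

    -- Filtered union and asymptotic universal Koszulity

    module _ (generated : GeneratedInDegree1 A)
             (koszul : (W : Subspace (component 1) a) → FiniteDimensional (submodule (component 1) W) →
                       IsUniversallyKoszul ⌞ A ⟨ W ⟩ ⌟) where

      private
        member-koszul : ∀ i → IsUniversallyKoszul ⌞ member i ⌟
        member-koszul (n , v) = koszul (spanOf (n , v)) (span-finiteDimensional (component 1) v)

        union : ∀ n (x : ∣ n ∣) → Σ[ i ∈ Index ] part (member i) n ∋ x
        union n x = Generated⇒finitelyGenerated (generated n x)

        member-connected : ∀ i → Connected ⌞ member i ⌟
        member-connected i = IsQuadratic.connected (IsUniversallyKoszul.isQuadratic (member-koszul i))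

      isFilteredUnion : IsFilteredUnionOfUniversallyKoszul A
      isFilteredUnion = record
        { system = finitelyGenerated ; universallyKoszul = member-koszul ; union = union }

      isAsymptoticallyUniversallyKoszul : IsAsymptoticallyUniversallyKoszul A
      isAsymptoticallyUniversallyKoszul = record
        { connected =
            -- Subalgebras inherit the equality, unit and scalar action of `A`. Injectivity of the
            -- unit map can therefore be read off in the member of the empty family, and
            -- surjectivity at `x` in any member containing `x`.
            (λ {c} {d} → proj₁ (member-connected (0 , [])) {c} {d}) ,
            (λ x → let i , x∈ = union 0 x in proj₂ (member-connected i) (x , x∈))
        ; generatedInDegree1 = generated
        ; system = finitelyGenerated
        ; universallyKoszul = member-koszul
        ; colimit≅ = λ n →
            -- Equality in the colimit asks for a stage above both indices; the joined family gives
            -- one.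
            (λ { {i , _} {j , _} e → i ⊔ᵢ j , inl i j , inr i j , e }) ,
            (λ x → let i , x∈ = union n x in (i , x , x∈) , λ { (_ , _ , _ , e) → e })
        -- The spanning vectors of `W` are pairs in the submodule; their first components form the
        -- index.
        ; absorbs = λ W fd → let n , v , _ = fd in
            (n , proj₁ ∘ v) , λ x∈ → gen (finiteDimensional⇒⊆span (component 1) W fd x∈)
        }

-- Algebras with local models, and Galois cohomology

module _ {c ℓ : Level} {p : ℕ} (A : GradedAlgebra (𝔽 p) (lsuc (c ⊔ ℓ))) (generated : GeneratedInDegree1 A)
         (model : (W : Subspace (GradedAlgebra.component A 1) (lsuc (c ⊔ ℓ))) →
                  FiniteDimensional (submodule (GradedAlgebra.component A 1) W) → LocalModel {c} {ℓ} A W) where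

  -- For each finite-dimensional `W`, `φ` identifies the subalgebra generated by `W` with the
  -- universally Koszul algebra `B`, so universal Koszulity transfers to that subalgebra.
  localModels⇒koszul : IsFilteredUnionOfUniversallyKoszul A × IsAsymptoticallyUniversallyKoszul A
  localModels⇒koszul = isFilteredUnion A generated koszul , isAsymptoticallyUniversallyKoszul A generated koszul
    where
    koszul : (W : Subspace (GradedAlgebra.component A 1) (lsuc (c ⊔ ℓ))) →
             FiniteDimensional (submodule (GradedAlgebra.component A 1) W) → IsUniversallyKoszul ⌞ A ⟨ W ⟩ ⌟
    koszul W fd = ≅-isUniversallyKoszul (LocalModel.φ (model W fd)) (LocalModel.universallyKoszul (model W fd))

theorem7p1 :
  {c ℓ : Level} (p : ℕ) → Prime p →
  (K : Field c ℓ) (Kˢ : SeparableClosure K) → ContainsRootsOfUnity K Kˢ p →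
  let A  = GaloisCohomology p K Kˢ
      A₁ = GradedAlgebra.component A 1 in
  GeneratedInDegree1 A →
  (model : (W : Subspace A₁ (lsuc (c ⊔ ℓ))) → FiniteDimensional (submodule A₁ W) → LocalModel {c} {ℓ} A W) →
  ((W W′ : Subspace A₁ (lsuc (c ⊔ ℓ)))
   (fd : FiniteDimensional (submodule A₁ W)) (fd′ : FiniteDimensional (submodule A₁ W′)) →
   W ⊆ₛ W′ →
   (A ⟨ W ⟩ ≤ A ⟨ W′ ⟩) × (LocalModel.B (model W fd) ↪ LocalModel.B (model W′ fd′))) →
  IsFilteredUnionOfUniversallyKoszul A × IsAsymptoticallyUniversallyKoszul A
theorem7p1 p _ K Kˢ _ generated model _ = localModels⇒koszul (GaloisCohomology p K Kˢ) generated model
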